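{- Let $T$ be a context-free raw type theory. If $\vdash_T\{y_1{:}B_1\}\cdots\{y_k{:}B_k\}\{x{:}A\}\,\mathcal J$ is derivable and $x\notin\mathrm{bv}(\mathcal J)$, then $\vdash_T\{y_1{:}B_1\}\cdots\{y_k{:}B_k\}\,\mathcal J$ is derivable.
   Context: Context-free raw syntax. A signature $\Sigma$ assigns to each symbol $S$ an arity $(c,[(c_1,n_1),\dots,(c_k,n_k)])$, $c\in\{\mathrm{Ty},\mathrm{Tm}\}$, $c_i\in\{\mathrm{Ty},\mathrm{Tm},\mathrm{EqTy},\mathrm{EqTm}\}$ (the $i$-th argument has class $c_i$ and binds $n_i$ variables). Free variables are annotated with types, $a^A$ ($A$ a type expression with no unbound bound variables); $a^A$ and $b^B$ are equal iff $a=b$ and $A=B$ syntactically. Metavariables are annotated with closed boundaries, $M^{\mathcal B}$, equal iff names and boundaries coincide; $M^{\mathcal B}$ has arity $(c,m)$ where $\mathcal B=\{x_1{:}A_1\}\cdots\{x_m{:}A_m\}\beta$ and $c$ is the class of $\beta$ (Ty, Tm, EqTy, EqTm). Type expressions: $S(e_1,\dots,e_k)$, $M^{\mathcal B}(t_1,\dots,t_n)$. Term expressions: $a^A$, bound variables $x$, $S(e_1,\dots,e_k)$, $M^{\mathcal B}(t_1,\dots,t_n)$, and conversion terms $\mathrm{cv}(t,\alpha)$. Assumption sets $\alpha$ are finite sets of annotated free variables, bound variables and annotated metavariables; they are the arguments of class EqTy/EqTm. Arguments: types, terms, assumption sets, abstractions $\{x\}e$. Judgement theses: $A\ \mathsf{type}$,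 $t:A$, $A\equiv B\ \mathsf{by}\ \alpha$, $s\equiv t:A\ \mathsf{by}\ \alpha$; abstracted judgements $\mathcal J::=\text{thesis}\mid\{x{:}A\}\mathcal J$ ($x$ bound in $\mathcal J$, not in $A$). Boundary theses $\Box\ \mathsf{type}$, $\Box:A$, $A\equiv B\ \mathsf{by}\ \Box$, $s\equiv t:A\ \mathsf{by}\ \Box$; abstracted boundaries $\mathcal B::=\text{thesis}\mid\{x{:}A\}\mathcal B$. Occurrences: $\mathrm{fv}(e)$ is the set of all annotated free variables occurring in $e$ (including in assumption sets and, recursively, in type annotations of occurring variables); $\mathrm{bv}(e)$ the set of bound variables occurring free (unbound by an abstraction) in $e$, including those in assumption sets; $\mathrm{mv}(e)$ the annotated metavariables occurring in $e$ (including inside annotations, boundaries of metavariables and assumption sets); $\mathrm{asm}(e)=\mathrm{fv}(e)\cup\mathrm{bv}(e)\cup\mathrm{mv}(e)$, and $\mathrm{asm}(e_1,\dots,e_n)=\bigcup_i\mathrm{asm}(e_i)$, extended componentwise to judgements and boundaries. Substitution $e[s/x]$ replaces the bound variable $x$ by $s$ (capture-avoiding), and in an assumption set containing $x$ replaces $x$ by the elements of $\mathrm{asm}(s)$. $\mathcal J[a^A/x]$ replaces $x$ by the free variable $a^A$. Erasure $|e|$ removes all conversions ($|\mathrm{cv}(t,\alpha)|=|t|$) and replaces assumption sets by a fixed dummy, keeping annotations. Filling: $(\Box\ \mathsf{type})[A]=(A\ \mathsf{type})$, $(\Box:A)[t]=(t:A)$, $(A\equiv B\ \mathsf{by}\ \Box)[e]=(A\equiv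 B\ \mathsf{by}\ \mathrm{asm}(e))$, $(s\equiv t:A\ \mathsf{by}\ \Box)[e]=(s\equiv t:A\ \mathsf{by}\ \mathrm{asm}(e))$, $(\{x{:}A\}\mathcal B)[\{x\}e]=\{x{:}A\}(\mathcal B[e])$; with equations: $(\Box\ \mathsf{type})[A_1\equiv A_2\ \mathsf{by}\ \alpha]=(A_1\equiv A_2\ \mathsf{by}\ \alpha)$, $(\Box:A)[t_1\equiv t_2\ \mathsf{by}\ \alpha]=(t_1\equiv t_2:A\ \mathsf{by}\ \alpha)$, commuting with abstraction. An instantiation $I=\langle M_1^{\mathcal B_1}\mapsto e_1,\dots,M_n^{\mathcal B_n}\mapsto e_n\rangle$ requires $\mathrm{mv}(\mathcal B_i)\subseteq\{M_1^{\mathcal B_1},\dots,M_{i-1}^{\mathcal B_{i-1}}\}$ and matching arities; $I_*(M_i^{\mathcal B_i}(\vec t))=e_i'[I_*\vec t/\vec x]$ where $e_i=\{\vec x\}e_i'$, $I_*a^A=a^{I_*A}$, $I_*\mathrm{cv}(t,\alpha)=\mathrm{cv}(I_*t,I_*\alpha)$, $I_*\alpha=\bigcup\{\mathrm{asm}(e_i):M_i^{\mathcal B_i}\in\alpha\}\cup\{x: x\in\alpha\}\cup\{a^{I_*A}:a^A\in\alpha\}$, homomorphic elsewhere; $I_{(i)}$ is the restriction to the first $i-1$ metavariables. Rules. A context-free raw rule is $M_1^{\mathcal B_1},\dots,M_n^{\mathcal B_n}\Longrightarrow\mathcal J$ with $\mathcal B_i$ and $\mathcal J$ closed (no free variables),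 $\mathcal J$ non-abstracted, $\mathrm{mv}(\mathcal B_i)\subseteq\{M_1^{\mathcal B_1},\dots,M_{i-1}^{\mathcal B_{i-1}}\}$ and $\mathrm{mv}(\mathcal J)=\{M_1^{\mathcal B_1},\dots,M_n^{\mathcal B_n}\}$. In a closure rule with premises $p_1,\dots,p_k$ and equality conclusion $\beta[\alpha]$, "$\alpha$ suitable" means $\mathrm{asm}(p_1,\dots,p_k)=\mathrm{asm}(\beta[\alpha])$. A context-free raw type theory $T$ is a family of such rules; $\vdash_T$ denotes membership in the least set of judgements and boundaries closed under: (CF-Var) $\vdash a^A:A$; (CF-Abstr) from $\vdash A\ \mathsf{type}$ and $\vdash\mathcal J[a^A/x]$ with $a^A\notin\mathrm{fv}(\mathcal J)$ infer $\vdash\{x{:}A\}\mathcal J$; (CF-Meta) for $\mathcal B=\{x_1{:}A_1\}\cdots\{x_n{:}A_n\}\beta$: from $\vdash t_i:A_i[t_1,\dots,t_{i-1}/x_1,\dots,x_{i-1}]$ ($i=1..n$) and $\vdash\beta[\vec t/\vec x]$ infer $\vdash(\beta[\vec t/\vec x])[M^{\mathcal B}(\vec t)]$ (for equality $\beta$ the assumption set is $\mathrm{asm}(M^{\mathcal B}(\vec t))$); (CF-Meta-Congr) for $\mathcal B=\{x_1{:}A_1\}\cdots\{x_m{:}A_m\}\beta$ with $\beta$ a type or term boundary: from $\vdash s_j:A_j[\vec s_{<j}/\vec x_{<j}]$, $\vdash t_j:A_j[\vec t_{<j}/\vec x_{<j}]$, and $\vdash s_j\equiv t'_j:A_j[\vec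 s_{<j}/\vec x_{<j}]\ \mathsf{by}\ \alpha_j$ with $|t'_j|=|t_j|$ ($j=1..m$), infer $\vdash M^{\mathcal B}(\vec s)\equiv M^{\mathcal B}(\vec t)\ \mathsf{by}\ \gamma$ if $\beta=\Box\ \mathsf{type}$, and, if $\beta=(\Box:B)$, given also $\vdash v:B[\vec s/\vec x]$ with $|v|=|M^{\mathcal B}(\vec t)|$, infer $\vdash M^{\mathcal B}(\vec s)\equiv v:B[\vec s/\vec x]\ \mathsf{by}\ \gamma$ ($\gamma$ suitable); (equality) from $\vdash A_1\ \mathsf{type}$, $\vdash A_2\ \mathsf{type}$, $|A_1|=|A_2|$ infer $\vdash A_1\equiv A_2\ \mathsf{by}\ \emptyset$; from $\vdash t_1:A$, $\vdash t_2:A$, $|t_1|=|t_2|$ infer $\vdash t_1\equiv t_2:A\ \mathsf{by}\ \emptyset$; symmetry keeping the assumption set; transitivity: from $\vdash A\equiv B\ \mathsf{by}\ \alpha$ and $\vdash B'\equiv C\ \mathsf{by}\ \beta$ with $|B|=|B'|$ infer $\vdash A\equiv C\ \mathsf{by}\ \gamma$ ($\gamma$ suitable), likewise for terms at a common type $A$ with $|t|=|t'|$; (CF-Conv-Tm) from $\vdash t:A$ and $\vdash A\equiv B\ \mathsf{by}\ \alpha$ infer $\vdash\mathrm{cv}(t,\beta):B$ whenever $\mathrm{asm}(t,A,B,\alpha)=\mathrm{asm}(t,B,\beta)$; (CF-Conv-EqTm) from $\vdash s\equiv t:A\ \mathsf{by}\ \alpha$ and $\vdash A\equiv B\ \mathsf{by}\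 \beta$ infer $\vdash\mathrm{cv}(s,\gamma)\equiv\mathrm{cv}(t,\delta):B\ \mathsf{by}\ \alpha$ whenever $\mathrm{asm}(s,A,B,\beta)=\mathrm{asm}(s,B,\gamma)$ and $\mathrm{asm}(t,A,B,\beta)=\mathrm{asm}(t,B,\delta)$; (boundaries) $\vdash\Box\ \mathsf{type}$; $\vdash\Box:A$ from $\vdash A\ \mathsf{type}$; $\vdash A\equiv B\ \mathsf{by}\ \Box$ from $\vdash A\ \mathsf{type}$, $\vdash B\ \mathsf{type}$; $\vdash s\equiv t:A\ \mathsf{by}\ \Box$ from $\vdash A\ \mathsf{type}$, $\vdash s:A$, $\vdash t:A$; $\vdash\{x{:}A\}\mathcal B$ from $\vdash A\ \mathsf{type}$ and $\vdash\mathcal B[a^A/x]$ with $a^A\notin\mathrm{fv}(\mathcal B)$; (specific rules) for a specific rule $M_1^{\mathcal B_1},\dots,M_n^{\mathcal B_n}\Longrightarrow\beta[e]$ and instantiation $I=\langle M_i^{\mathcal B_i}\mapsto e_i\rangle$: from $\vdash(I_{(i)*}\mathcal B_i)[e_i]$ ($i=1..n$) and $\vdash I_*\beta$ infer $\vdash I_*(\beta[e])$; (congruence) for a specific rule with conclusion $A\ \mathsf{type}$ (resp. $t:A$) and instantiations $I=\langle M_i\mapsto f_i\rangle$, $J=\langle M_i\mapsto g_i\rangle$: from $\vdash(I_{(i)*}\mathcal B_i)[f_i]$, $\vdash(J_{(i)*}\mathcal B_i)[g_i]$ for all $i$, and for each type/term boundary $\mathcal B_i$ some $g'_i$ with $|g'_i|=|g_i|$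 and $\vdash(I_{(i)*}\mathcal B_i)[f_i\equiv g'_i\ \mathsf{by}\ \alpha_i]$, infer $\vdash I_*A\equiv J_*A\ \mathsf{by}\ \gamma$ (resp., given also $\vdash t':I_*A$ with $|t'|=|J_*t|$, infer $\vdash I_*t\equiv t':I_*A\ \mathsf{by}\ \gamma$), $\gamma$ suitable. -}

module Defs where

-- Bound variables: intrinsically scoped de Bruijn indices (index 0 = innermost binder).
-- Free variables a^A and metavariables M^B are named by natural numbers and carry
-- their annotation.  Flag 'clo' = syntax without free variables (closed), 'opn' = general.

open import Data.Nat using (ℕ; zero; suc; _<_)
open import Data.Fin using (Fin; zero; suc; toℕ)
open import Data.List using (List; []; _∷_; _++_; map; concat; tabulate)
open import Data.List.Membership.Propositional using (_∈_)
open import Data.Product using (Σ; _×_; _,_; ∃)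
open import Relation.Binary.PropositionalEquality using (_≡_)
open import Relation.Nullary using (¬_)

data Flag : Set where
  clo opn : Flag

data Cls : Set where
  ty tm : Cls

data ACls : Set where
  Ty Tm EqTy EqTm : ACls

⌜_⌝ : Cls → ACls
⌜ ty ⌝ = Ty
⌜ tm ⌝ = Tm

data IsObj : ACls → Set where
  oTy : IsObj Ty
  oTm : IsObj Tm

-- k ⊕ n : scope after adding k binders to scope n (definitionally suc k ⊕ n = k ⊕ suc n)
_⊕_ : ℕ → ℕ → ℕ
zero ⊕ n = n
suc k ⊕ n = k ⊕ suc n

record Signature : Set₁ where
  field
    Symb : Set
    symCls : Symb → Cls
    symArgs : Symb → List (ACls × ℕ)

module Raw (Sg : Signature) where
  open Signature Sg

  data Expr : Flag → Cls → ℕ → Set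
  data Args : Flag → ℕ → List (ACls × ℕ) → Set
  data Arg : Flag → ℕ → ACls → ℕ → Set
  data Tms : Flag → ℕ → ℕ → Set
  data Atom : Flag → ℕ → Set
  data Bd : Flag → ACls → ℕ → Set
  -- abstracted boundary: flag, class, scope, number of abstractions
  data ABdry : Flag → ACls → ℕ → ℕ → Set

  data Expr where
    fvar : ∀ {n} → ℕ → Expr opn ty 0 → Expr opn tm n
    bvar : ∀ {F n} → Fin n → Expr F tm n
    sym : ∀ {F n} (S : Symb) → Args F n (symArgs S) → Expr F (symCls S) n
    meta : ∀ {F n c m} → ℕ → ABdry clo ⌜ c ⌝ 0 m → Tms F n m → Expr F c n
    cv : ∀ {F n} → Expr F tm n → List (Atom F n) → Expr F tm n

  data Args where
    anil : ∀ {F n} → Args F n []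
    acons : ∀ {F n c k as} → Arg F n c k → Args F n as → Args F n ((c , k) ∷ as)

  data Arg where
    aty : ∀ {F n k} → Expr F ty (k ⊕ n) → Arg F n Ty k
    atm : ∀ {F n k} → Expr F tm (k ⊕ n) → Arg F n Tm k
    aeqty : ∀ {F n k} → List (Atom F (k ⊕ n)) → Arg F n EqTy k
    aeqtm : ∀ {F n k} → List (Atom F (k ⊕ n)) → Arg F n EqTm k

  data Tms where
    tnil : ∀ {F n} → Tms F n 0
    tcons : ∀ {F n m} → Expr F tm n → Tms F n m → Tms F n (suc m)

  -- elements of assumption sets (finite sets represented by lists)
  data Atom where
    afv : ∀ {n} → ℕ → Expr opn ty 0 → Atom opn n
    abv : ∀ {F n} → Fin n → Atom F n
    amv : ∀ {F n} → ℕ → (c : ACls) → ∀ {m} → ABdry clo c 0 m → Atom F n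

  data Bd where
    bty : ∀ {F n} → Bd F Ty n
    btm : ∀ {F n} → Expr F ty n → Bd F Tm n
    beqty : ∀ {F n} → Expr F ty n → Expr F ty n → Bd F EqTy n
    beqtm : ∀ {F n} → Expr F tm n → Expr F tm n → Expr F ty n → Bd F EqTm n

  data ABdry where
    bthesis : ∀ {F c n} → Bd F c n → ABdry F c n 0
    babs : ∀ {F c n m} → Expr F ty n → ABdry F c (suc n) m → ABdry F c n (suc m)

  data Jdg (F : Flag) (n : ℕ) : Set where
    isTy : Expr F ty n → Jdg F n
    hasTy : Expr F tm n → Expr F ty n → Jdg F n
    eqTy : Expr F ty n → Expr F ty n → List (Atom F n) → Jdg F n
    eqTm : Expr F tm n → Expr F tm n → Expr F ty n → List (Atom F n) → Jdg F n

  data AJdg (F : Flag) : ℕ → Set where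
    thesis : ∀ {n} → Jdg F n → AJdg F n
    jabs : ∀ {n} → Expr F ty n → AJdg F (suc n) → AJdg F n

  Ren : ℕ → ℕ → Set
  Ren m n = Fin m → Fin n

  liftR : ∀ {m n} → Ren m n → Ren (suc m) (suc n)
  liftR ρ zero = zero
  liftR ρ (suc i) = suc (ρ i)

  liftRk : ∀ k {m n} → Ren m n → Ren (k ⊕ m) (k ⊕ n)
  liftRk zero ρ = ρ
  liftRk (suc k) ρ = liftRk k (liftR ρ)

  renE : ∀ {F c m n} → Ren m n → Expr F c m → Expr F c n
  renArgs : ∀ {F m n as} → Ren m n → Args F m as → Args F n as
  renArg : ∀ {F m n c k} → Ren m n → Arg F m c k → Arg F n c k
  renTms : ∀ {F m n l} → Ren m n → Tms F m l → Tms F n l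
  renAt : ∀ {F m n} → Ren m n → Atom F m → Atom F n
  renAts : ∀ {F m n} → Ren m n → List (Atom F m) → List (Atom F n)

  renE ρ (fvar a A) = fvar a A
  renE ρ (bvar i) = bvar (ρ i)
  renE ρ (sym S as) = sym S (renArgs ρ as)
  renE ρ (meta M B ts) = meta M B (renTms ρ ts)
  renE ρ (cv t α) = cv (renE ρ t) (renAts ρ α)
  renArgs ρ anil = anil
  renArgs ρ (acons a as) = acons (renArg ρ a) (renArgs ρ as)
  renArg ρ (aty {k = k} e) = aty (renE (liftRk k ρ) e)
  renArg ρ (atm {k = k} e) = atm (renE (liftRk k ρ) e)
  renArg ρ (aeqty {k = k} α) = aeqty (renAts (liftRk k ρ) α)
  renArg ρ (aeqtm {k = k} α) = aeqtm (renAts (liftRk k ρ) α)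
  renTms ρ tnil = tnil
  renTms ρ (tcons t ts) = tcons (renE ρ t) (renTms ρ ts)
  renAt ρ (afv a A) = afv a A
  renAt ρ (abv i) = abv (ρ i)
  renAt ρ (amv M c B) = amv M c B
  renAts ρ [] = []
  renAts ρ (z ∷ α) = renAt ρ z ∷ renAts ρ α

  renJ : ∀ {F m n} → Ren m n → Jdg F m → Jdg F n
  renJ ρ (isTy A) = isTy (renE ρ A)
  renJ ρ (hasTy t A) = hasTy (renE ρ t) (renE ρ A)
  renJ ρ (eqTy A B α) = eqTy (renE ρ A) (renE ρ B) (renAts ρ α)
  renJ ρ (eqTm s t A α) = eqTm (renE ρ s) (renE ρ t) (renE ρ A) (renAts ρ α)

  renAJ : ∀ {F m n} → Ren m n → AJdg F m → AJdg F n
  renAJ ρ (thesis J) = thesis (renJ ρ J)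
  renAJ ρ (jabs A J) = jabs (renE ρ A) (renAJ (liftR ρ) J)

  wkAJ : ∀ {F n} → AJdg F n → AJdg F (suc n)
  wkAJ = renAJ suc

  -- asm(e) = fv(e) ∪ bv(e) ∪ mv(e)  (as a list; duplicates irrelevant)

  closeAt : ∀ {F n} → Atom clo 0 → Atom F n
  closeAt (abv ())
  closeAt (amv M c B) = amv M c B

  unbind1 : ∀ {F n} → List (Atom F (suc n)) → List (Atom F n)
  unbind1 [] = []
  unbind1 (afv a A ∷ xs) = afv a A ∷ unbind1 xs
  unbind1 (abv zero ∷ xs) = unbind1 xs
  unbind1 (abv (suc i) ∷ xs) = abv i ∷ unbind1 xs
  unbind1 (amv M c B ∷ xs) = amv M c B ∷ unbind1 xs

  unbind : ∀ {F n} k → List (Atom F (k ⊕ n)) → List (Atom F n)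
  unbind zero xs = xs
  unbind (suc k) xs = unbind1 (unbind k xs)

  asmE : ∀ {F c n} → Expr F c n → List (Atom F n)
  asmArgs : ∀ {F n as} → Args F n as → List (Atom F n)
  asmArg : ∀ {F n c k} → Arg F n c k → List (Atom F n)
  asmTms : ∀ {F n m} → Tms F n m → List (Atom F n)
  asmAt : ∀ {F n} → Atom F n → List (Atom F n)
  asmAts : ∀ {F n} → List (Atom F n) → List (Atom F n)
  asmBd : ∀ {F c n} → Bd F c n → List (Atom F n)
  asmAB : ∀ {F c n m} → ABdry F c n m → List (Atom F n)

  asmE (fvar a A) = afv a A ∷ renAts (λ ()) (asmE A)
  asmE (bvar i) = abv i ∷ []
  asmE (sym S as) = asmArgs as
  asmE (meta {c = c} M B ts) = amv M ⌜ c ⌝ B ∷ (map closeAt (asmAB B) ++ asmTms ts)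
  asmE (cv t α) = asmE t ++ asmAts α
  asmArgs anil = []
  asmArgs (acons a as) = asmArg a ++ asmArgs as
  asmArg (aty {k = k} e) = unbind k (asmE e)
  asmArg (atm {k = k} e) = unbind k (asmE e)
  asmArg (aeqty {k = k} α) = unbind k (asmAts α)
  asmArg (aeqtm {k = k} α) = unbind k (asmAts α)
  asmTms tnil = []
  asmTms (tcons t ts) = asmE t ++ asmTms ts
  asmAt (afv a A) = afv a A ∷ renAts (λ ()) (asmE A)
  asmAt (abv i) = abv i ∷ []
  asmAt (amv M c B) = amv M c B ∷ map closeAt (asmAB B)
  asmAts [] = []
  asmAts (z ∷ α) = asmAt z ++ asmAts α
  asmBd bty = []
  asmBd (btm A) = asmE A
  asmBd (beqty A B) = asmE A ++ asmE B
  asmBd (beqtm s t A) = asmE s ++ asmE t ++ asmE A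
  asmAB (bthesis β) = asmBd β
  asmAB (babs A B) = asmE A ++ unbind1 (asmAB B)

  asmJ : ∀ {F n} → Jdg F n → List (Atom F n)
  asmJ (isTy A) = asmE A
  asmJ (hasTy t A) = asmE t ++ asmE A
  asmJ (eqTy A B α) = asmE A ++ asmE B ++ asmAts α
  asmJ (eqTm s t A α) = asmE s ++ asmE t ++ asmE A ++ asmAts α

  asmAJ : ∀ {F n} → AJdg F n → List (Atom F n)
  asmAJ (thesis J) = asmJ J
  asmAJ (jabs A J) = asmE A ++ unbind1 (asmAJ J)

  asmMv : ∀ {n m} → ℕ → (c : ACls) → ABdry clo c 0 m → Tms opn n m → List (Atom opn n)
  asmMv M c B ts = amv M c B ∷ (map closeAt (asmAB B) ++ asmTms ts)

  Sb : ℕ → ℕ → Set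
  Sb m n = Fin m → Expr opn tm n

  liftS : ∀ {m n} → Sb m n → Sb (suc m) (suc n)
  liftS σ zero = bvar zero
  liftS σ (suc i) = renE suc (σ i)

  liftSk : ∀ k {m n} → Sb m n → Sb (k ⊕ m) (k ⊕ n)
  liftSk zero σ = σ
  liftSk (suc k) σ = liftSk k (liftS σ)

  subE : ∀ {F c m n} → Sb m n → Expr F c m → Expr opn c n
  subArgs : ∀ {F m n as} → Sb m n → Args F m as → Args opn n as
  subArg : ∀ {F m n c k} → Sb m n → Arg F m c k → Arg opn n c k
  subTms : ∀ {F m n l} → Sb m n → Tms F m l → Tms opn n l
  subAt : ∀ {F m n} → Sb m n → Atom F m → List (Atom opn n)
  subAts : ∀ {F m n} → Sb m n → List (Atom F m) → List (Atom opn n)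

  subE σ (fvar a A) = fvar a A
  subE σ (bvar i) = σ i
  subE σ (sym S as) = sym S (subArgs σ as)
  subE σ (meta M B ts) = meta M B (subTms σ ts)
  subE σ (cv t α) = cv (subE σ t) (subAts σ α)
  subArgs σ anil = anil
  subArgs σ (acons a as) = acons (subArg σ a) (subArgs σ as)
  subArg σ (aty {k = k} e) = aty (subE (liftSk k σ) e)
  subArg σ (atm {k = k} e) = atm (subE (liftSk k σ) e)
  subArg σ (aeqty {k = k} α) = aeqty (subAts (liftSk k σ) α)
  subArg σ (aeqtm {k = k} α) = aeqtm (subAts (liftSk k σ) α)
  subTms σ tnil = tnil
  subTms σ (tcons t ts) = tcons (subE σ t) (subTms σ ts)
  -- a bound variable x in an assumption set is replaced by the elements of asm(s)
  subAt σ (afv a A) = afv a A ∷ []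
  subAt σ (abv i) = asmE (σ i)
  subAt σ (amv M c B) = amv M c B ∷ []
  subAts σ [] = []
  subAts σ (z ∷ α) = subAt σ z ++ subAts σ α

  subBd : ∀ {F c m n} → Sb m n → Bd F c m → Bd opn c n
  subBd σ bty = bty
  subBd σ (btm A) = btm (subE σ A)
  subBd σ (beqty A B) = beqty (subE σ A) (subE σ B)
  subBd σ (beqtm s t A) = beqtm (subE σ s) (subE σ t) (subE σ A)

  subAB : ∀ {F c m n k} → Sb m n → ABdry F c m k → ABdry opn c n k
  subAB σ (bthesis β) = bthesis (subBd σ β)
  subAB σ (babs A B) = babs (subE σ A) (subAB (liftS σ) B)

  subJ : ∀ {F m n} → Sb m n → Jdg F m → Jdg opn n
  subJ σ (isTy A) = isTy (subE σ A)
  subJ σ (hasTy t A) = hasTy (subE σ t) (subE σ A)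
  subJ σ (eqTy A B α) = eqTy (subE σ A) (subE σ B) (subAts σ α)
  subJ σ (eqTm s t A α) = eqTm (subE σ s) (subE σ t) (subE σ A) (subAts σ α)

  subAJ : ∀ {F m n} → Sb m n → AJdg F m → AJdg opn n
  subAJ σ (thesis J) = thesis (subJ σ J)
  subAJ σ (jabs A J) = jabs (subE σ A) (subAJ (liftS σ) J)

  _▸_ : ∀ {m n} → Expr opn tm n → Sb m n → Sb (suc m) n
  (s ▸ σ) zero = s
  (s ▸ σ) (suc i) = σ i

  sub0 : ∀ {n} → Expr opn tm n → Sb (suc n) n
  sub0 s = s ▸ bvar

  embAB : ∀ {F c n m} → ABdry F c n m → ABdry opn c n m
  embAB = subAB bvar

  -- substitution of t₁ … t_m for the bound variables x₁ … x_m (x_m innermost)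
  extSub : ∀ {n m j} → Tms opn n m → Sb j n → Sb (m ⊕ j) n
  extSub tnil σ = σ
  extSub (tcons t ts) σ = extSub ts (t ▸ σ)

  eraseE : ∀ {F c n} → Expr F c n → Expr F c n
  eraseArgs : ∀ {F n as} → Args F n as → Args F n as
  eraseArg : ∀ {F n c k} → Arg F n c k → Arg F n c k
  eraseTms : ∀ {F n m} → Tms F n m → Tms F n m

  eraseE (fvar a A) = fvar a A
  eraseE (bvar i) = bvar i
  eraseE (sym S as) = sym S (eraseArgs as)
  eraseE (meta M B ts) = meta M B (eraseTms ts)
  eraseE (cv t α) = eraseE t
  eraseArgs anil = anil
  eraseArgs (acons a as) = acons (eraseArg a) (eraseArgs as)
  eraseArg (aty e) = aty (eraseE e)
  eraseArg (atm e) = atm (eraseE e)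
  eraseArg (aeqty α) = aeqty []
  eraseArg (aeqtm α) = aeqtm []
  eraseTms tnil = tnil
  eraseTms (tcons t ts) = tcons (eraseE t) (eraseTms ts)

  -- Syntactic identity of raw syntax with assumption sets regarded as finite
  -- sets (list representatives compared by mutual inclusion, recursively).

  data _≃E_ : ∀ {F c n} → Expr F c n → Expr F c n → Set
  data _≃As_ : ∀ {F n as} → Args F n as → Args F n as → Set
  data _≃A_ : ∀ {F n c k} → Arg F n c k → Arg F n c k → Set
  data _≃T_ : ∀ {F n m} → Tms F n m → Tms F n m → Set
  data _≃at_ : ∀ {F n} → Atom F n → Atom F n → Set
  data Mem : ∀ {F n} → Atom F n → List (Atom F n) → Set
  data _⊆̃_ : ∀ {F n} → List (Atom F n) → List (Atom F n) → Set
  data _≃Bd_ : ∀ {F c n} → Bd F c n → Bd F c n → Set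
  data _≃B_ : ∀ {F c n m} → ABdry F c n m → ABdry F c n m → Set

  data _≃E_ where
    efv : ∀ {n a A A'} → A ≃E A' → _≃E_ {opn} {tm} {n} (fvar a A) (fvar a A')
    ebv : ∀ {F n} {i : Fin n} → _≃E_ {F} (bvar i) (bvar i)
    esym : ∀ {F n S} {as as' : Args F n (symArgs S)} → as ≃As as' → sym S as ≃E sym S as'
    emeta : ∀ {F n c m M} {B B' : ABdry clo ⌜ c ⌝ 0 m} {ts ts' : Tms F n m} →
            B ≃B B' → ts ≃T ts' → meta {c = c} M B ts ≃E meta M B' ts'
    ecv : ∀ {F n} {t t' : Expr F tm n} {α α'} → t ≃E t' → α ⊆̃ α' → α' ⊆̃ α → cv t α ≃E cv t' α'

  data _≃As_ where
    eanil : ∀ {F n} → _≃As_ {F} {n} anil anil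
    eacons : ∀ {F n c k as} {a a' : Arg F n c k} {r r' : Args F n as} →
             a ≃A a' → r ≃As r' → acons a r ≃As acons a' r'

  data _≃A_ where
    eaty : ∀ {F n k} {e e' : Expr F ty (k ⊕ n)} → e ≃E e' → aty {n = n} e ≃A aty {k = k} e'
    eatm : ∀ {F n k} {e e' : Expr F tm (k ⊕ n)} → e ≃E e' → atm {n = n} e ≃A atm {k = k} e'
    eaeqty : ∀ {F n k} {α α' : List (Atom F (k ⊕ n))} → α ⊆̃ α' → α' ⊆̃ α → aeqty {n = n} α ≃A aeqty {k = k} α'
    eaeqtm : ∀ {F n k} {α α' : List (Atom F (k ⊕ n))} → α ⊆̃ α' → α' ⊆̃ α → aeqtm {n = n} α ≃A aeqtm {k = k} α'

  data _≃T_ where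
    etnil : ∀ {F n} → _≃T_ {F} {n} tnil tnil
    etcons : ∀ {F n m} {t t' : Expr F tm n} {ts ts' : Tms F n m} →
             t ≃E t' → ts ≃T ts' → tcons t ts ≃T tcons t' ts'

  data _≃at_ where
    eafv : ∀ {n a A A'} → A ≃E A' → _≃at_ {opn} {n} (afv a A) (afv a A')
    eabv : ∀ {F n} {i : Fin n} → _≃at_ {F} (abv i) (abv i)
    eamv : ∀ {F n M c m} {B B' : ABdry clo c 0 m} → B ≃B B' → _≃at_ {F} {n} (amv M c B) (amv M c B')

  data Mem where
    here : ∀ {F n} {z z' : Atom F n} {β} → z ≃at z' → Mem z (z' ∷ β)
    there : ∀ {F n} {z z' : Atom F n} {β} → Mem z β → Mem z (z' ∷ β)

  data _⊆̃_ where
    snil : ∀ {F n} {β : List (Atom F n)} → [] ⊆̃ β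
    scons : ∀ {F n} {z : Atom F n} {α β} → Mem z β → α ⊆̃ β → (z ∷ α) ⊆̃ β

  data _≃Bd_ where
    ebty : ∀ {F n} → _≃Bd_ {F} {Ty} {n} bty bty
    ebtm : ∀ {F n} {A A' : Expr F ty n} → A ≃E A' → btm A ≃Bd btm A'
    ebeqty : ∀ {F n} {A A' B B' : Expr F ty n} → A ≃E A' → B ≃E B' → beqty A B ≃Bd beqty A' B'
    ebeqtm : ∀ {F n} {s s' t t' : Expr F tm n} {A A'} → s ≃E s' → t ≃E t' → A ≃E A' →
             beqtm s t A ≃Bd beqtm s' t' A'

  data _≃B_ where
    ebthesis : ∀ {F c n} {β β' : Bd F c n} → β ≃Bd β' → bthesis β ≃B bthesis β'
    ebabs : ∀ {F c n m} {A A' : Expr F ty n} {B B' : ABdry F c (suc n) m} →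
            A ≃E A' → B ≃B B' → babs A B ≃B babs A' B'

  data _≃J_ {F : Flag} {n : ℕ} : Jdg F n → Jdg F n → Set where
    eisTy : ∀ {A A'} → A ≃E A' → isTy A ≃J isTy A'
    ehasTy : ∀ {t t' A A'} → t ≃E t' → A ≃E A' → hasTy t A ≃J hasTy t' A'
    eeqTy : ∀ {A A' B B' α α'} → A ≃E A' → B ≃E B' → α ⊆̃ α' → α' ⊆̃ α →
            eqTy A B α ≃J eqTy A' B' α'
    eeqTm : ∀ {s s' t t' A A' α α'} → s ≃E s' → t ≃E t' → A ≃E A' → α ⊆̃ α' → α' ⊆̃ α →
            eqTm s t A α ≃J eqTm s' t' A' α'

  data _≃AJ_ {F : Flag} : ∀ {n} → AJdg F n → AJdg F n → Set where
    ethesis : ∀ {n} {J J' : Jdg F n} → J ≃J J' → thesis J ≃AJ thesis J'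
    ejabs : ∀ {n} {A A' : Expr F ty n} {J J'} → A ≃E A' → J ≃AJ J' → jabs A J ≃AJ jabs A' J'

  _≈ₛ_ : ∀ {F n} → List (Atom F n) → List (Atom F n) → Set
  α ≈ₛ β = (α ⊆̃ β) × (β ⊆̃ α)

  fillBd : ∀ {F c n} → Bd F c n → Arg F n c 0 → Jdg F n
  fillBd bty (aty A) = isTy A
  fillBd (btm A) (atm t) = hasTy t A
  fillBd (beqty A B) (aeqty α) = eqTy A B (asmAts α)
  fillBd (beqtm s t A) (aeqtm α) = eqTm s t A (asmAts α)

  shiftArg : ∀ {F n c k} → Arg F n c (suc k) → Arg F (suc n) c k
  shiftArg (aty e) = aty e
  shiftArg (atm e) = atm e
  shiftArg (aeqty α) = aeqty α
  shiftArg (aeqtm α) = aeqtm α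

  fillA : ∀ {F c n m} → ABdry F c n m → Arg F n c m → AJdg F n
  fillA (bthesis β) e = thesis (fillBd β e)
  fillA (babs A B) e = jabs A (fillA B (shiftArg e))

  fillEqBd : ∀ {F c n} → Bd F c n → IsObj c → Arg F n c 0 → Arg F n c 0 → List (Atom F n) → Jdg F n
  fillEqBd bty oTy (aty A₁) (aty A₂) α = eqTy A₁ A₂ α
  fillEqBd (btm A) oTm (atm t₁) (atm t₂) α = eqTm t₁ t₂ A α

  fillEqA : ∀ {F c n m} → ABdry F c n m → IsObj c → Arg F n c m → Arg F n c m →
            List (Atom F (m ⊕ n)) → AJdg F n
  fillEqA (bthesis β) o e₁ e₂ α = thesis (fillEqBd β o e₁ e₂ α)
  fillEqA (babs A B) o e₁ e₂ α = jabs A (fillEqA B o (shiftArg e₁) (shiftArg e₂) α)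

  jcls : ∀ {F n} → Jdg F n → ACls
  jcls (isTy _) = Ty
  jcls (hasTy _ _) = Tm
  jcls (eqTy _ _ _) = EqTy
  jcls (eqTm _ _ _ _) = EqTm

  bdryOf : ∀ {F n} → (J : Jdg F n) → Bd F (jcls J) n
  bdryOf (isTy A) = bty
  bdryOf (hasTy t A) = btm A
  bdryOf (eqTy A B α) = beqty A B
  bdryOf (eqTm s t A α) = beqtm s t A

  record MVar : Set where
    constructor mvd
    field
      mname : ℕ
      mcls : ACls
      mar : ℕ
      mbd : ABdry clo mcls 0 mar

  mvAtom : ∀ {F n} → MVar → Atom F n
  mvAtom d = amv (MVar.mname d) (MVar.mcls d) (MVar.mbd d)

  ArgOf : MVar → Set
  ArgOf d = Arg opn 0 (MVar.mcls d) (MVar.mar d)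

  data IsMv {F : Flag} {n : ℕ} : Atom F n → Set where
    ismv : ∀ {M c m} {B : ABdry clo c 0 m} → IsMv (amv M c B)

  record Rule : Set where
    field
      len : ℕ
      prem : Fin len → MVar
      concl : Jdg clo 0
      premWf : ∀ (i : Fin len) (z : Atom clo 0) → z ∈ asmAB (MVar.mbd (prem i)) → IsMv z →
               ∃ λ (j : Fin len) → (toℕ j < toℕ i) × (z ≡ mvAtom (prem j))
      conclWf₁ : ∀ (z : Atom clo 0) → z ∈ asmJ concl → IsMv z → ∃ λ (j : Fin len) → z ≡ mvAtom (prem j)
      conclWf₂ : ∀ (j : Fin len) → mvAtom (prem j) ∈ asmJ concl

  record Theory : Set₁ where
    field
      RIdx : Set
      rule : RIdx → Rule

  plug : ∀ {c n m} → Arg opn 0 ⌜ c ⌝ m → Tms opn n m → Expr opn c n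
  plug {ty} (aty e) ts = subE (extSub ts (λ ())) e
  plug {tm} (atm e) ts = subE (extSub ts (λ ())) e

  -- The action I_* of the instantiation I = ⟨M_j ↦ es j⟩_{j<b} (for b = len: I itself;
  -- for b = i: the restriction I_(i)), as a relation between closed rule syntax and its
  -- instance.
  module Inst {N : ℕ} (prem : Fin N → MVar) (es : (j : Fin N) → ArgOf (prem j)) (b : ℕ) where

    data Look : (M : ℕ) (c : ACls) {m : ℕ} → ABdry clo c 0 m → Arg opn 0 c m → Set where
      look : (j : Fin N) → toℕ j < b →
             Look (MVar.mname (prem j)) (MVar.mcls (prem j)) (MVar.mbd (prem j)) (es j)

    data IE : ∀ {c n} → Expr clo c n → Expr opn c n → Set
    data IArgs : ∀ {n as} → Args clo n as → Args opn n as → Set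
    data IArg : ∀ {n c k} → Arg clo n c k → Arg opn n c k → Set
    data ITms : ∀ {n m} → Tms clo n m → Tms opn n m → Set
    data IAt : ∀ {n} → Atom clo n → List (Atom opn n) → Set
    data IAts : ∀ {n} → List (Atom clo n) → List (Atom opn n) → Set

    data IE where
      ibv : ∀ {n} {i : Fin n} → IE (bvar i) (bvar i)
      isym : ∀ {n S} {as : Args clo n (symArgs S)} {as'} → IArgs as as' → IE (sym S as) (sym S as')
      imeta : ∀ {c n m M} {B : ABdry clo ⌜ c ⌝ 0 m} {e : Arg opn 0 ⌜ c ⌝ m}
                {ts : Tms clo n m} {ts'} →
              Look M ⌜ c ⌝ B e → ITms ts ts' → IE (meta {c = c} M B ts) (plug e ts')
      icv : ∀ {n} {t : Expr clo tm n} {t' α α'} → IE t t' → IAts α α' → IE (cv t α) (cv t' α')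

    data IArgs where
      ianil : ∀ {n} → IArgs {n} anil anil
      iacons : ∀ {n c k as} {a : Arg clo n c k} {a'} {r : Args clo n as} {r'} →
               IArg a a' → IArgs r r' → IArgs (acons a r) (acons a' r')

    data IArg where
      iaty : ∀ {n k} {e : Expr clo ty (k ⊕ n)} {e'} → IE e e' → IArg (aty {n = n} {k = k} e) (aty {k = k} e')
      iatm : ∀ {n k} {e : Expr clo tm (k ⊕ n)} {e'} → IE e e' → IArg (atm {n = n} {k = k} e) (atm {k = k} e')
      iaeqty : ∀ {n k} {α : List (Atom clo (k ⊕ n))} {α'} → IAts α α' → IArg (aeqty {n = n} {k = k} α) (aeqty {k = k} α')
      iaeqtm : ∀ {n k} {α : List (Atom clo (k ⊕ n))} {α'} → IAts α α' → IArg (aeqtm {n = n} {k = k} α) (aeqtm {k = k} α')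

    data ITms where
      itnil : ∀ {n} → ITms {n} tnil tnil
      itcons : ∀ {n m} {t : Expr clo tm n} {t'} {ts : Tms clo n m} {ts'} →
               IE t t' → ITms ts ts' → ITms (tcons t ts) (tcons t' ts')

    data IAt where
      iabv : ∀ {n} {i : Fin n} → IAt (abv i) (abv i ∷ [])
      iamv : ∀ {n M c m} {B : ABdry clo c 0 m} {e} → Look M c B e →
             IAt {n} (amv M c B) (renAts (λ ()) (asmArg e))

    data IAts where
      iatnil : ∀ {n} → IAts {n} [] []
      iatcons : ∀ {n} {z : Atom clo n} {zs α α'} → IAt z zs → IAts α α' → IAts (z ∷ α) (zs ++ α')

    data IBd : ∀ {c n} → Bd clo c n → Bd opn c n → Set where
      ibty : ∀ {n} → IBd {Ty} {n} bty bty
      ibtm : ∀ {n} {A : Expr clo ty n} {A'} → IE A A' → IBd (btm A) (btm A')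
      ibeqty : ∀ {n} {A B : Expr clo ty n} {A' B'} → IE A A' → IE B B' → IBd (beqty A B) (beqty A' B')
      ibeqtm : ∀ {n} {s t : Expr clo tm n} {A s' t' A'} → IE s s' → IE t t' → IE A A' →
               IBd (beqtm s t A) (beqtm s' t' A')

    data IAB : ∀ {c n m} → ABdry clo c n m → ABdry opn c n m → Set where
      ibthesis : ∀ {c n} {β : Bd clo c n} {β'} → IBd β β' → IAB (bthesis β) (bthesis β')
      ibabs : ∀ {c n m} {A : Expr clo ty n} {A'} {B : ABdry clo c (suc n) m} {B'} →
              IE A A' → IAB B B' → IAB (babs A B) (babs A' B')

    data IJ : ∀ {n} → Jdg clo n → Jdg opn n → Set where
      ijty : ∀ {n} {A : Expr clo ty n} {A'} → IE A A' → IJ (isTy A) (isTy A')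
      ijtm : ∀ {n} {t : Expr clo tm n} {A t' A'} → IE t t' → IE A A' → IJ (hasTy t A) (hasTy t' A')
      ijeqty : ∀ {n} {A B : Expr clo ty n} {α A' B' α'} → IE A A' → IE B B' → IAts α α' →
               IJ (eqTy A B α) (eqTy A' B' α')
      ijeqtm : ∀ {n} {s t : Expr clo tm n} {A α s' t' A' α'} → IE s s' → IE t t' → IE A A' →
               IAts α α' → IJ (eqTm s t A α) (eqTm s' t' A' α')

  withObj : ∀ {X : Set} (c : ACls) → (IsObj c → List X) → List X
  withObj Ty f = f oTy
  withObj Tm f = f oTm
  withObj EqTy f = []
  withObj EqTm f = []

  module Deriv (T : Theory) where
    open Theory T

    L : RIdx → ℕ
    L r = Rule.len (rule r)

    P : (r : RIdx) → Fin (L r) → MVar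
    P r = Rule.prem (rule r)

    C : RIdx → Jdg clo 0
    C r = Rule.concl (rule r)

    cls : (r : RIdx) → Fin (L r) → ACls
    cls r j = MVar.mcls (P r j)

    ar : (r : RIdx) → Fin (L r) → ℕ
    ar r j = MVar.mar (P r j)

    congAsm : (r : RIdx) (fs gs g's : (j : Fin (L r)) → ArgOf (P r j))
              (αs : (j : Fin (L r)) → List (Atom opn (ar r j ⊕ 0)))
              (Bf Bg : (j : Fin (L r)) → ABdry opn (cls r j) 0 (ar r j)) → List (Atom opn 0)
    congAsm r fs gs g's αs Bf Bg =
      concat (tabulate λ j → asmAJ (fillA (Bf j) (fs j)) ++ asmAJ (fillA (Bg j) (gs j))
                             ++ withObj (cls r j) (λ o → asmAJ (fillEqA (Bf j) o (fs j) (g's j) (αs j))))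

    data ⊢_ : AJdg opn 0 → Set
    data ⊢ᵇ_ : ∀ {c m} → ABdry opn c 0 m → Set
    -- premises of CF-Meta: ⊢ t_i : A_i[t₁…t_{i-1}/x₁…x_{i-1}], result boundary β[t⃗/x⃗]
    data Tel : ∀ {c m} → ABdry opn c 0 m → Tms opn 0 m → Bd opn c 0 → Set
    -- premises of CF-Meta-Congr, together with the collected asm of these premises
    data CTel : ∀ {c m} → ABdry opn c 0 m → ABdry opn c 0 m → Tms opn 0 m → Tms opn 0 m →
                Bd opn c 0 → Bd opn c 0 → List (Atom opn 0) → Set

    data Tel where
      tel-nil : ∀ {c} {β : Bd opn c 0} → Tel (bthesis β) tnil β
      tel-cons : ∀ {c m} {A : Expr opn ty 0} {B : ABdry opn c 1 m} {t ts β} →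
                 ⊢ thesis (hasTy t A) → Tel (subAB (sub0 t) B) ts β → Tel (babs A B) (tcons t ts) β

    data CTel where
      ctel-nil : ∀ {c} {β β' : Bd opn c 0} → CTel (bthesis β) (bthesis β') tnil tnil β β' []
      ctel-cons : ∀ {c m} {A A' : Expr opn ty 0} {B B' : ABdry opn c 1 m} {s t ss ts β β' Q}
                  (t' : Expr opn tm 0) (α : List (Atom opn 0)) →
                  ⊢ thesis (hasTy s A) → ⊢ thesis (hasTy t A') →
                  eraseE t' ≃E eraseE t → ⊢ thesis (eqTm s t' A α) →
                  CTel (subAB (sub0 s) B) (subAB (sub0 t) B') ss ts β β' Q →
                  CTel (babs A B) (babs A' B') (tcons s ss) (tcons t ts) β β'
                       (asmJ (hasTy s A) ++ asmJ (hasTy t A') ++ asmJ (eqTm s t' A α) ++ Q)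

    data ⊢_ where
      -- identity of judgements up to assumption sets being sets
      j-set : ∀ {J J'} → ⊢ J → J ≃AJ J' → ⊢ J'
      cf-var : ∀ a (A : Expr opn ty 0) → ⊢ thesis (hasTy (fvar a A) A)
      cf-abstr : ∀ {A : Expr opn ty 0} {J : AJdg opn 1} a →
                 ⊢ thesis (isTy A) → ¬ Mem (afv a A) (asmAJ J) →
                 ⊢ subAJ (sub0 (fvar a A)) J → ⊢ jabs A J
      cf-meta-ty : ∀ M {m} (B : ABdry clo Ty 0 m) ts (β : Bd opn Ty 0) →
                   Tel (embAB B) ts β → ⊢ᵇ bthesis β → ⊢ thesis (fillBd β (aty (meta {c = ty} M B ts)))
      cf-meta-tm : ∀ M {m} (B : ABdry clo Tm 0 m) ts (β : Bd opn Tm 0) →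
                   Tel (embAB B) ts β → ⊢ᵇ bthesis β → ⊢ thesis (fillBd β (atm (meta {c = tm} M B ts)))
      cf-meta-eqty : ∀ M {m} (B : ABdry clo EqTy 0 m) ts (A₁ A₂ : Expr opn ty 0) →
                     Tel (embAB B) ts (beqty A₁ A₂) → ⊢ᵇ bthesis (beqty A₁ A₂) →
                     ⊢ thesis (eqTy A₁ A₂ (asmMv M EqTy B ts))
      cf-meta-eqtm : ∀ M {m} (B : ABdry clo EqTm 0 m) ts (s t : Expr opn tm 0) (A : Expr opn ty 0) →
                     Tel (embAB B) ts (beqtm s t A) → ⊢ᵇ bthesis (beqtm s t A) →
                     ⊢ thesis (eqTm s t A (asmMv M EqTm B ts))
      cf-meta-congr-ty : ∀ M {m} (B : ABdry clo Ty 0 m) ss ts Q (γ : List (Atom opn 0)) →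
                         CTel (embAB B) (embAB B) ss ts bty bty Q →
                         Q ≈ₛ asmJ (eqTy (meta {c = ty} M B ss) (meta {c = ty} M B ts) γ) →
                         ⊢ thesis (eqTy (meta {c = ty} M B ss) (meta {c = ty} M B ts) γ)
      cf-meta-congr-tm : ∀ M {m} (B : ABdry clo Tm 0 m) ss ts (Bs Bt : Expr opn ty 0) Q
                         (v : Expr opn tm 0) (γ : List (Atom opn 0)) →
                         CTel (embAB B) (embAB B) ss ts (btm Bs) (btm Bt) Q →
                         ⊢ thesis (hasTy v Bs) → eraseE v ≃E eraseE (meta {c = tm} M B ts) →
                         (Q ++ asmJ (hasTy v Bs)) ≈ₛ asmJ (eqTm (meta {c = tm} M B ss) v Bs γ) →
                         ⊢ thesis (eqTm (meta {c = tm} M B ss) v Bs γ)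
      eq-ty-refl : ∀ {A₁ A₂} → ⊢ thesis (isTy A₁) → ⊢ thesis (isTy A₂) → eraseE A₁ ≃E eraseE A₂ →
                   ⊢ thesis (eqTy A₁ A₂ [])
      eq-tm-refl : ∀ {t₁ t₂ A} → ⊢ thesis (hasTy t₁ A) → ⊢ thesis (hasTy t₂ A) →
                   eraseE t₁ ≃E eraseE t₂ → ⊢ thesis (eqTm t₁ t₂ A [])
      eq-ty-sym : ∀ {A B α} → ⊢ thesis (eqTy A B α) → ⊢ thesis (eqTy B A α)
      eq-tm-sym : ∀ {s t A α} → ⊢ thesis (eqTm s t A α) → ⊢ thesis (eqTm t s A α)
      eq-ty-trans : ∀ {A B B' C α β} (γ : List (Atom opn 0)) →
                    ⊢ thesis (eqTy A B α) → ⊢ thesis (eqTy B' C β) → eraseE B ≃E eraseE B' →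
                    (asmJ (eqTy A B α) ++ asmJ (eqTy B' C β)) ≈ₛ asmJ (eqTy A C γ) →
                    ⊢ thesis (eqTy A C γ)
      eq-tm-trans : ∀ {s t t' u A α β} (γ : List (Atom opn 0)) →
                    ⊢ thesis (eqTm s t A α) → ⊢ thesis (eqTm t' u A β) → eraseE t ≃E eraseE t' →
                    (asmJ (eqTm s t A α) ++ asmJ (eqTm t' u A β)) ≈ₛ asmJ (eqTm s u A γ) →
                    ⊢ thesis (eqTm s u A γ)
      cf-conv-tm : ∀ {t A B α} (β : List (Atom opn 0)) →
                   ⊢ thesis (hasTy t A) → ⊢ thesis (eqTy A B α) →
                   (asmE t ++ asmE A ++ asmE B ++ asmAts α) ≈ₛ (asmE t ++ asmE B ++ asmAts β) →
                   ⊢ thesis (hasTy (cv t β) B)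
      cf-conv-eqtm : ∀ {s t A B α β} (γ δ : List (Atom opn 0)) →
                     ⊢ thesis (eqTm s t A α) → ⊢ thesis (eqTy A B β) →
                     (asmE s ++ asmE A ++ asmE B ++ asmAts β) ≈ₛ (asmE s ++ asmE B ++ asmAts γ) →
                     (asmE t ++ asmE A ++ asmE B ++ asmAts β) ≈ₛ (asmE t ++ asmE B ++ asmAts δ) →
                     ⊢ thesis (eqTm (cv s γ) (cv t δ) B α)
      specific : (r : RIdx) (es : (j : Fin (L r)) → ArgOf (P r j))
                 (Bs : (j : Fin (L r)) → ABdry opn (cls r j) 0 (ar r j)) →
                 ((j : Fin (L r)) → Inst.IAB (P r) es (toℕ j) (MVar.mbd (P r j)) (Bs j)) →
                 ((j : Fin (L r)) → ⊢ fillA (Bs j) (es j)) →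
                 (β : Bd opn (jcls (C r)) 0) → Inst.IBd (P r) es (L r) (bdryOf (C r)) β → ⊢ᵇ bthesis β →
                 (J : Jdg opn 0) → Inst.IJ (P r) es (L r) (C r) J → ⊢ thesis J
      congr-ty : (r : RIdx) (fs gs g's : (j : Fin (L r)) → ArgOf (P r j))
                 (αs : (j : Fin (L r)) → List (Atom opn (ar r j ⊕ 0)))
                 (Bf Bg : (j : Fin (L r)) → ABdry opn (cls r j) 0 (ar r j)) →
                 ((j : Fin (L r)) → Inst.IAB (P r) fs (toℕ j) (MVar.mbd (P r j)) (Bf j)) →
                 ((j : Fin (L r)) → Inst.IAB (P r) gs (toℕ j) (MVar.mbd (P r j)) (Bg j)) →
                 ((j : Fin (L r)) → ⊢ fillA (Bf j) (fs j)) →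
                 ((j : Fin (L r)) → ⊢ fillA (Bg j) (gs j)) →
                 ((j : Fin (L r)) → IsObj (cls r j) → eraseArg (g's j) ≃A eraseArg (gs j)) →
                 ((j : Fin (L r)) (o : IsObj (cls r j)) → ⊢ fillEqA (Bf j) o (fs j) (g's j) (αs j)) →
                 (A : Expr clo ty 0) → C r ≡ isTy A →
                 (Af Ag : Expr opn ty 0) → Inst.IE (P r) fs (L r) A Af → Inst.IE (P r) gs (L r) A Ag →
                 (γ : List (Atom opn 0)) →
                 congAsm r fs gs g's αs Bf Bg ≈ₛ asmJ (eqTy Af Ag γ) →
                 ⊢ thesis (eqTy Af Ag γ)
      congr-tm : (r : RIdx) (fs gs g's : (j : Fin (L r)) → ArgOf (P r j))
                 (αs : (j : Fin (L r)) → List (Atom opn (ar r j ⊕ 0)))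
                 (Bf Bg : (j : Fin (L r)) → ABdry opn (cls r j) 0 (ar r j)) →
                 ((j : Fin (L r)) → Inst.IAB (P r) fs (toℕ j) (MVar.mbd (P r j)) (Bf j)) →
                 ((j : Fin (L r)) → Inst.IAB (P r) gs (toℕ j) (MVar.mbd (P r j)) (Bg j)) →
                 ((j : Fin (L r)) → ⊢ fillA (Bf j) (fs j)) →
                 ((j : Fin (L r)) → ⊢ fillA (Bg j) (gs j)) →
                 ((j : Fin (L r)) → IsObj (cls r j) → eraseArg (g's j) ≃A eraseArg (gs j)) →
                 ((j : Fin (L r)) (o : IsObj (cls r j)) → ⊢ fillEqA (Bf j) o (fs j) (g's j) (αs j)) →
                 (t : Expr clo tm 0) (A : Expr clo ty 0) → C r ≡ hasTy t A →
                 (tf tg : Expr opn tm 0) (Af : Expr opn ty 0) →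
                 Inst.IE (P r) fs (L r) t tf → Inst.IE (P r) fs (L r) A Af → Inst.IE (P r) gs (L r) t tg →
                 (t' : Expr opn tm 0) → ⊢ thesis (hasTy t' Af) → eraseE t' ≃E eraseE tg →
                 (γ : List (Atom opn 0)) →
                 (congAsm r fs gs g's αs Bf Bg ++ asmJ (hasTy t' Af)) ≈ₛ asmJ (eqTm tf t' Af γ) →
                 ⊢ thesis (eqTm tf t' Af γ)

    data ⊢ᵇ_ where
      b-set : ∀ {c m} {B B' : ABdry opn c 0 m} → ⊢ᵇ B → B ≃B B' → ⊢ᵇ B'
      b-ty : ⊢ᵇ bthesis bty
      b-tm : ∀ {A} → ⊢ thesis (isTy A) → ⊢ᵇ bthesis (btm A)
      b-eqty : ∀ {A B} → ⊢ thesis (isTy A) → ⊢ thesis (isTy B) → ⊢ᵇ bthesis (beqty A B)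
      b-eqtm : ∀ {A s t} → ⊢ thesis (isTy A) → ⊢ thesis (hasTy s A) → ⊢ thesis (hasTy t A) →
               ⊢ᵇ bthesis (beqtm s t A)
      b-abs : ∀ {c m} {A : Expr opn ty 0} {B : ABdry opn c 1 m} a →
              ⊢ thesis (isTy A) → ¬ Mem (afv a A) (asmAB B) →
              ⊢ᵇ subAB (sub0 (fvar a A)) B → ⊢ᵇ babs A B

  Derivable : Theory → AJdg opn 0 → Set
  Derivable T J = Deriv.⊢_ T J

  data Tele : ℕ → Set where
    ε : Tele 0
    _▷_ : ∀ {k} → Tele k → Expr opn ty k → Tele (suc k)

  wrap : ∀ {k} → Tele k → AJdg opn k → AJdg opn 0
  wrap ε J = J
  wrap (Γ ▷ B) J = wrap Γ (jabs B J)

open Raw public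

{-# OPTIONS --safe #-}
-- A judgement J with x ∉ bv(J) is the weakening wk J′ of a judgement J′ over one variable
-- fewer, so it suffices to drop the abstraction {x:A} from {y⃗:B⃗}{x:A} wk J′.  The only rules
-- concluding an abstracted judgement are CF-Abstr and the replacement of assumption sets by
-- set-equal ones.  For {x:A} itself the premise of CF-Abstr is (wk J′)[a/x] = J′.  For an
-- outer abstraction {y:B} the premise is its body with a fresh a^B for y; substitution
-- commutes with weakening, so x can be dropped there and y abstracted again, the freshness
-- condition surviving because dropping x only shrinks assumption sets.  Set-equality steps
-- are transported because whatever is set-equal to a weakening is itself a weakening.
module Submission where

open import Data.Nat using (ℕ; zero; suc)
open import Data.Fin using (Fin; zero; suc)
open import Data.Fin.Properties using (suc-injective)
open import Data.List using (List; []; _∷_; _++_; map)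
open import Data.List.Relation.Unary.Any using (here; there)
open import Data.List.Membership.Propositional using (_∈_)
open import Data.List.Membership.Propositional.Properties using (∈-++⁺ˡ; ∈-++⁺ʳ)
open import Data.List.Relation.Binary.Subset.Propositional using (_⊆_)
open import Data.List.Relation.Binary.Subset.Propositional.Properties using (++⁺ʳ)
open import Data.Product using (Σ; ∃; _×_; _,_)
open import Data.Empty using (⊥-elim)
open import Function using (_∘_)
open import Function.Definitions using (Injective)
open import Relation.Binary.PropositionalEquality as ≡
  using (_≡_; _≗_; refl; trans; cong; cong₂; subst; module ≡-Reasoning)
open import Relation.Nullary using (¬_)
import Defs

cong₃ : ∀ {A B C D : Set} (f : A → B → C → D) {a a′ b b′ c c′} →
        a ≡ a′ → b ≡ b′ → c ≡ c′ → f a b c ≡ f a′ b′ c′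
cong₃ f refl refl refl = refl

cong₄ : ∀ {A B C D E : Set} (f : A → B → C → D → E) {a a′ b b′ c c′ d d′} →
        a ≡ a′ → b ≡ b′ → c ≡ c′ → d ≡ d′ →
        f a b c d ≡ f a′ b′ c′ d′
cong₄ f refl refl refl refl = refl

module Strengthening (Sg : Defs.Signature) where
  open Defs using (Flag; clo; opn; ty; tm; _⊕_)
  open Defs.Raw Sg

  private variable
    F : Flag
    k l m n : ℕ

  -- Renaming and substitution

  renAts-++ : (ρ : Ren m n) (xs ys : List (Atom F m)) →
              renAts ρ (xs ++ ys) ≡ renAts ρ xs ++ renAts ρ ys
  renAts-++ ρ [] ys = refl
  renAts-++ ρ (x ∷ xs) ys = cong (renAt ρ x ∷_) (renAts-++ ρ xs ys)

  ≡-renAts-++ : ∀ {ρ : Ren m n} {xs ys : List (Atom F m)} {xs′ ys′} →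
                xs′ ≡ renAts ρ xs → ys′ ≡ renAts ρ ys →
                xs′ ++ ys′ ≡ renAts ρ (xs ++ ys)
  ≡-renAts-++ {ρ = ρ} {xs} {ys} refl refl = ≡.sym (renAts-++ ρ xs ys)

  renAts-closeAt : (ρ : Ren m n) (xs : List (Atom clo 0)) →
                   renAts {F} ρ (map closeAt xs) ≡ map closeAt xs
  renAts-closeAt ρ [] = refl
  renAts-closeAt ρ (abv () ∷ xs)
  renAts-closeAt ρ (amv M c B ∷ xs) = cong (amv M c B ∷_) (renAts-closeAt ρ xs)

  liftR-∘ : {ρ : Ren m n} {τ : Ren l m} {υ : Ren l n} →
            ρ ∘ τ ≗ υ → liftR ρ ∘ liftR τ ≗ liftR υ
  liftR-∘ h zero = refl
  liftR-∘ h (suc i) = cong suc (h i)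

  liftRk-∘ : ∀ k {ρ : Ren m n} {τ : Ren l m} {υ : Ren l n} →
             ρ ∘ τ ≗ υ → liftRk k ρ ∘ liftRk k τ ≗ liftRk k υ
  liftRk-∘ zero h = h
  liftRk-∘ (suc k) h = liftRk-∘ k (liftR-∘ h)

  renE-∘ : ∀ {c} {ρ : Ren m n} {τ : Ren l m} {υ : Ren l n} →
           ρ ∘ τ ≗ υ → (e : Expr F c l) → renE ρ (renE τ e) ≡ renE υ e
  renArgs-∘ : ∀ {as} {ρ : Ren m n} {τ : Ren l m} {υ : Ren l n} →
              ρ ∘ τ ≗ υ → (e : Args F l as) → renArgs ρ (renArgs τ e) ≡ renArgs υ e
  renArg-∘ : ∀ {c} {ρ : Ren m n} {τ : Ren l m} {υ : Ren l n} →
             ρ ∘ τ ≗ υ → (e : Arg F l c k) → renArg ρ (renArg τ e) ≡ renArg υ e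
  renTms-∘ : {ρ : Ren m n} {τ : Ren l m} {υ : Ren l n} →
             ρ ∘ τ ≗ υ → (e : Tms F l k) → renTms ρ (renTms τ e) ≡ renTms υ e
  renAts-∘ : {ρ : Ren m n} {τ : Ren l m} {υ : Ren l n} →
             ρ ∘ τ ≗ υ → (α : List (Atom F l)) →
             renAts ρ (renAts τ α) ≡ renAts υ α

  renE-∘ h (fvar a A) = refl
  renE-∘ h (bvar i) = cong bvar (h i)
  renE-∘ h (sym S as) = cong (sym S) (renArgs-∘ h as)
  renE-∘ h (meta M B ts) = cong (meta M B) (renTms-∘ h ts)
  renE-∘ h (cv t α) = cong₂ cv (renE-∘ h t) (renAts-∘ h α)
  renArgs-∘ h anil = refl
  renArgs-∘ h (acons a as) = cong₂ acons (renArg-∘ h a) (renArgs-∘ h as)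
  renArg-∘ h (aty {k = k} e) = cong aty (renE-∘ (liftRk-∘ k h) e)
  renArg-∘ h (atm {k = k} e) = cong atm (renE-∘ (liftRk-∘ k h) e)
  renArg-∘ h (aeqty {k = k} α) = cong aeqty (renAts-∘ (liftRk-∘ k h) α)
  renArg-∘ h (aeqtm {k = k} α) = cong aeqtm (renAts-∘ (liftRk-∘ k h) α)
  renTms-∘ h tnil = refl
  renTms-∘ h (tcons t ts) = cong₂ tcons (renE-∘ h t) (renTms-∘ h ts)
  renAts-∘ h [] = refl
  renAts-∘ h (afv a A ∷ α) = cong (afv a A ∷_) (renAts-∘ h α)
  renAts-∘ h (abv i ∷ α) = cong₂ _∷_ (cong abv (h i)) (renAts-∘ h α)
  renAts-∘ h (amv M c B ∷ α) = cong (amv M c B ∷_) (renAts-∘ h α)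

  unbind1-renAts : (ρ : Ren m n) (xs : List (Atom F (suc m))) →
                   unbind1 (renAts (liftR ρ) xs) ≡ renAts ρ (unbind1 xs)
  unbind1-renAts ρ [] = refl
  unbind1-renAts ρ (afv a A ∷ xs) = cong (afv a A ∷_) (unbind1-renAts ρ xs)
  unbind1-renAts ρ (abv zero ∷ xs) = unbind1-renAts ρ xs
  unbind1-renAts ρ (abv (suc i) ∷ xs) = cong (abv (ρ i) ∷_) (unbind1-renAts ρ xs)
  unbind1-renAts ρ (amv M c B ∷ xs) = cong (amv M c B ∷_) (unbind1-renAts ρ xs)

  unbind-renAts : ∀ k (ρ : Ren m n) (xs : List (Atom F (k ⊕ m))) →
                  unbind k (renAts (liftRk k ρ) xs) ≡ renAts ρ (unbind k xs)
  unbind-renAts zero ρ xs = refl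
  unbind-renAts (suc k) ρ xs =
    trans (cong unbind1 (unbind-renAts k (liftR ρ) xs)) (unbind1-renAts ρ (unbind k xs))

  unbind1-wk : (xs : List (Atom F n)) → unbind1 (renAts suc xs) ≡ xs
  unbind1-wk [] = refl
  unbind1-wk (afv a A ∷ xs) = cong (afv a A ∷_) (unbind1-wk xs)
  unbind1-wk (abv i ∷ xs) = cong (abv i ∷_) (unbind1-wk xs)
  unbind1-wk (amv M c B ∷ xs) = cong (amv M c B ∷_) (unbind1-wk xs)

  asmE-renE : ∀ {c} (ρ : Ren m n) (e : Expr F c m) → asmE (renE ρ e) ≡ renAts ρ (asmE e)
  asmArgs-renArgs : ∀ {as} (ρ : Ren m n) (e : Args F m as) →
                    asmArgs (renArgs ρ e) ≡ renAts ρ (asmArgs e)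
  asmArg-renArg : ∀ {c} (ρ : Ren m n) (e : Arg F m c k) →
                  asmArg (renArg ρ e) ≡ renAts ρ (asmArg e)
  asmTms-renTms : (ρ : Ren m n) (e : Tms F m k) →
                  asmTms (renTms ρ e) ≡ renAts ρ (asmTms e)
  asmAts-renAts : (ρ : Ren m n) (α : List (Atom F m)) →
                  asmAts (renAts ρ α) ≡ renAts ρ (asmAts α)

  asmE-renE ρ (fvar a A) = cong (afv a A ∷_) (≡.sym (renAts-∘ (λ ()) (asmE A)))
  asmE-renE ρ (bvar i) = refl
  asmE-renE ρ (sym S as) = asmArgs-renArgs ρ as
  asmE-renE ρ (meta M B ts) =
    cong (amv M _ B ∷_)
         (≡-renAts-++ (≡.sym (renAts-closeAt ρ (asmAB B))) (asmTms-renTms ρ ts))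
  asmE-renE ρ (cv t α) = ≡-renAts-++ (asmE-renE ρ t) (asmAts-renAts ρ α)
  asmArgs-renArgs ρ anil = refl
  asmArgs-renArgs ρ (acons a as) = ≡-renAts-++ (asmArg-renArg ρ a) (asmArgs-renArgs ρ as)
  asmArg-renArg ρ (aty {k = k} e) =
    trans (cong (unbind k) (asmE-renE (liftRk k ρ) e)) (unbind-renAts k ρ (asmE e))
  asmArg-renArg ρ (atm {k = k} e) =
    trans (cong (unbind k) (asmE-renE (liftRk k ρ) e)) (unbind-renAts k ρ (asmE e))
  asmArg-renArg ρ (aeqty {k = k} α) =
    trans (cong (unbind k) (asmAts-renAts (liftRk k ρ) α)) (unbind-renAts k ρ (asmAts α))
  asmArg-renArg ρ (aeqtm {k = k} α) =
    trans (cong (unbind k) (asmAts-renAts (liftRk k ρ) α)) (unbind-renAts k ρ (asmAts α))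
  asmTms-renTms ρ tnil = refl
  asmTms-renTms ρ (tcons t ts) = ≡-renAts-++ (asmE-renE ρ t) (asmTms-renTms ρ ts)
  asmAts-renAts ρ [] = refl
  asmAts-renAts ρ (afv a A ∷ α) =
    ≡-renAts-++ (cong (afv a A ∷_) (≡.sym (renAts-∘ (λ ()) (asmE A))))
                (asmAts-renAts ρ α)
  asmAts-renAts ρ (abv i ∷ α) = cong (abv (ρ i) ∷_) (asmAts-renAts ρ α)
  asmAts-renAts ρ (amv M c B ∷ α) =
    ≡-renAts-++ (cong (amv M c B ∷_) (≡.sym (renAts-closeAt ρ (asmAB B))))
                (asmAts-renAts ρ α)

  asmJ-renJ : (ρ : Ren m n) (J : Jdg F m) → asmJ (renJ ρ J) ≡ renAts ρ (asmJ J)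
  asmJ-renJ ρ (isTy A) = asmE-renE ρ A
  asmJ-renJ ρ (hasTy t A) = ≡-renAts-++ (asmE-renE ρ t) (asmE-renE ρ A)
  asmJ-renJ ρ (eqTy A B α) =
    ≡-renAts-++ (asmE-renE ρ A) (≡-renAts-++ (asmE-renE ρ B) (asmAts-renAts ρ α))
  asmJ-renJ ρ (eqTm s t A α) =
    ≡-renAts-++ (asmE-renE ρ s)
      (≡-renAts-++ (asmE-renE ρ t) (≡-renAts-++ (asmE-renE ρ A) (asmAts-renAts ρ α)))

  asmAJ-renAJ : (ρ : Ren m n) (J : AJdg F m) → asmAJ (renAJ ρ J) ≡ renAts ρ (asmAJ J)
  asmAJ-renAJ ρ (thesis J) = asmJ-renJ ρ J
  asmAJ-renAJ ρ (jabs A J) =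
    ≡-renAts-++ (asmE-renE ρ A)
      (trans (cong unbind1 (asmAJ-renAJ (liftR ρ) J)) (unbind1-renAts ρ (asmAJ J)))

  unbind1-asmAJ-wkAJ : (J : AJdg F n) → unbind1 (asmAJ (wkAJ J)) ≡ asmAJ J
  unbind1-asmAJ-wkAJ J = trans (cong unbind1 (asmAJ-renAJ suc J)) (unbind1-wk (asmAJ J))

  liftS-liftR : {σ : Sb m n} {ρ : Ren l m} {τ : Sb l n} →
                σ ∘ ρ ≗ τ → liftS σ ∘ liftR ρ ≗ liftS τ
  liftS-liftR h zero = refl
  liftS-liftR h (suc i) = cong (renE suc) (h i)

  liftSk-liftRk : ∀ k {σ : Sb m n} {ρ : Ren l m} {τ : Sb l n} →
                  σ ∘ ρ ≗ τ → liftSk k σ ∘ liftRk k ρ ≗ liftSk k τ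
  liftSk-liftRk zero h = h
  liftSk-liftRk (suc k) h = liftSk-liftRk k (liftS-liftR h)

  subE-renE : ∀ {c} {σ : Sb m n} {ρ : Ren l m} {τ : Sb l n} →
              σ ∘ ρ ≗ τ → (e : Expr F c l) → subE σ (renE ρ e) ≡ subE τ e
  subArgs-renArgs : ∀ {as} {σ : Sb m n} {ρ : Ren l m} {τ : Sb l n} →
                    σ ∘ ρ ≗ τ → (e : Args F l as) →
                    subArgs σ (renArgs ρ e) ≡ subArgs τ e
  subArg-renArg : ∀ {c} {σ : Sb m n} {ρ : Ren l m} {τ : Sb l n} →
                  σ ∘ ρ ≗ τ → (e : Arg F l c k) → subArg σ (renArg ρ e) ≡ subArg τ e
  subTms-renTms : {σ : Sb m n} {ρ : Ren l m} {τ : Sb l n} →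
                  σ ∘ ρ ≗ τ → (e : Tms F l k) → subTms σ (renTms ρ e) ≡ subTms τ e
  subAts-renAts : {σ : Sb m n} {ρ : Ren l m} {τ : Sb l n} →
                  σ ∘ ρ ≗ τ → (α : List (Atom F l)) →
                  subAts σ (renAts ρ α) ≡ subAts τ α

  subE-renE h (fvar a A) = refl
  subE-renE h (bvar i) = h i
  subE-renE h (sym S as) = cong (sym S) (subArgs-renArgs h as)
  subE-renE h (meta M B ts) = cong (meta M B) (subTms-renTms h ts)
  subE-renE h (cv t α) = cong₂ cv (subE-renE h t) (subAts-renAts h α)
  subArgs-renArgs h anil = refl
  subArgs-renArgs h (acons a as) = cong₂ acons (subArg-renArg h a) (subArgs-renArgs h as)
  subArg-renArg h (aty {k = k} e) = cong aty (subE-renE (liftSk-liftRk k h) e)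
  subArg-renArg h (atm {k = k} e) = cong atm (subE-renE (liftSk-liftRk k h) e)
  subArg-renArg h (aeqty {k = k} α) = cong aeqty (subAts-renAts (liftSk-liftRk k h) α)
  subArg-renArg h (aeqtm {k = k} α) = cong aeqtm (subAts-renAts (liftSk-liftRk k h) α)
  subTms-renTms h tnil = refl
  subTms-renTms h (tcons t ts) = cong₂ tcons (subE-renE h t) (subTms-renTms h ts)
  subAts-renAts h [] = refl
  subAts-renAts h (afv a A ∷ α) = cong (afv a A ∷_) (subAts-renAts h α)
  subAts-renAts h (abv i ∷ α) = cong₂ _++_ (cong asmE (h i)) (subAts-renAts h α)
  subAts-renAts h (amv M c B ∷ α) = cong (amv M c B ∷_) (subAts-renAts h α)

  subAJ-renAJ : {σ : Sb m n} {ρ : Ren l m} {τ : Sb l n} →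
                σ ∘ ρ ≗ τ → (J : AJdg F l) → subAJ σ (renAJ ρ J) ≡ subAJ τ J
  subAJ-renAJ h (thesis (isTy A)) = cong (thesis ∘ isTy) (subE-renE h A)
  subAJ-renAJ h (thesis (hasTy t A)) = cong thesis (cong₂ hasTy (subE-renE h t) (subE-renE h A))
  subAJ-renAJ h (thesis (eqTy A B α)) =
    cong thesis (cong₃ eqTy (subE-renE h A) (subE-renE h B) (subAts-renAts h α))
  subAJ-renAJ h (thesis (eqTm s t A α)) =
    cong thesis (cong₄ eqTm (subE-renE h s) (subE-renE h t) (subE-renE h A) (subAts-renAts h α))
  subAJ-renAJ h (jabs A J) = cong₂ jabs (subE-renE h A) (subAJ-renAJ (liftS-liftR h) J)

  liftR-liftS : {ρ : Ren m n} {σ : Sb l m} {τ : Sb l n} →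
                renE ρ ∘ σ ≗ τ → renE (liftR ρ) ∘ liftS σ ≗ liftS τ
  liftR-liftS h zero = refl
  liftR-liftS {ρ = ρ} {σ} {τ} h (suc i) = begin
    renE (liftR ρ) (renE suc (σ i))  ≡⟨ renE-∘ (λ _ → refl) (σ i) ⟩
    renE (suc ∘ ρ) (σ i)             ≡⟨ ≡.sym (renE-∘ (λ _ → refl) (σ i)) ⟩
    renE suc (renE ρ (σ i))          ≡⟨ cong (renE suc) (h i) ⟩
    renE suc (τ i)                   ∎
    where open ≡-Reasoning

  liftRk-liftSk : ∀ k {ρ : Ren m n} {σ : Sb l m} {τ : Sb l n} →
                  renE ρ ∘ σ ≗ τ →
                  renE (liftRk k ρ) ∘ liftSk k σ ≗ liftSk k τ
  liftRk-liftSk zero h = h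
  liftRk-liftSk (suc k) h = liftRk-liftSk k (liftR-liftS h)

  renE-subE : ∀ {c} {ρ : Ren m n} {σ : Sb l m} {τ : Sb l n} →
              renE ρ ∘ σ ≗ τ → (e : Expr F c l) → renE ρ (subE σ e) ≡ subE τ e
  renArgs-subArgs : ∀ {as} {ρ : Ren m n} {σ : Sb l m} {τ : Sb l n} →
                    renE ρ ∘ σ ≗ τ → (e : Args F l as) →
                    renArgs ρ (subArgs σ e) ≡ subArgs τ e
  renArg-subArg : ∀ {c} {ρ : Ren m n} {σ : Sb l m} {τ : Sb l n} →
                  renE ρ ∘ σ ≗ τ → (e : Arg F l c k) →
                  renArg ρ (subArg σ e) ≡ subArg τ e
  renTms-subTms : {ρ : Ren m n} {σ : Sb l m} {τ : Sb l n} →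
                  renE ρ ∘ σ ≗ τ → (e : Tms F l k) →
                  renTms ρ (subTms σ e) ≡ subTms τ e
  renAts-subAts : {ρ : Ren m n} {σ : Sb l m} {τ : Sb l n} →
                  renE ρ ∘ σ ≗ τ → (α : List (Atom F l)) →
                  renAts ρ (subAts σ α) ≡ subAts τ α

  renE-subE h (fvar a A) = refl
  renE-subE h (bvar i) = h i
  renE-subE h (sym S as) = cong (sym S) (renArgs-subArgs h as)
  renE-subE h (meta M B ts) = cong (meta M B) (renTms-subTms h ts)
  renE-subE h (cv t α) = cong₂ cv (renE-subE h t) (renAts-subAts h α)
  renArgs-subArgs h anil = refl
  renArgs-subArgs h (acons a as) = cong₂ acons (renArg-subArg h a) (renArgs-subArgs h as)
  renArg-subArg h (aty {k = k} e) = cong aty (renE-subE (liftRk-liftSk k h) e)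
  renArg-subArg h (atm {k = k} e) = cong atm (renE-subE (liftRk-liftSk k h) e)
  renArg-subArg h (aeqty {k = k} α) = cong aeqty (renAts-subAts (liftRk-liftSk k h) α)
  renArg-subArg h (aeqtm {k = k} α) = cong aeqtm (renAts-subAts (liftRk-liftSk k h) α)
  renTms-subTms h tnil = refl
  renTms-subTms h (tcons t ts) = cong₂ tcons (renE-subE h t) (renTms-subTms h ts)
  renAts-subAts h [] = refl
  renAts-subAts h (afv a A ∷ α) = cong (afv a A ∷_) (renAts-subAts h α)
  renAts-subAts {ρ = ρ} {σ} h (abv i ∷ α) =
    ≡.sym (≡-renAts-++ (trans (cong asmE (≡.sym (h i))) (asmE-renE ρ (σ i)))
                       (≡.sym (renAts-subAts h α)))
  renAts-subAts h (amv M c B ∷ α) = cong (amv M c B ∷_) (renAts-subAts h α)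

  renAJ-subAJ : {ρ : Ren m n} {σ : Sb l m} {τ : Sb l n} →
                renE ρ ∘ σ ≗ τ → (J : AJdg F l) → renAJ ρ (subAJ σ J) ≡ subAJ τ J
  renAJ-subAJ h (thesis (isTy A)) = cong (thesis ∘ isTy) (renE-subE h A)
  renAJ-subAJ h (thesis (hasTy t A)) = cong thesis (cong₂ hasTy (renE-subE h t) (renE-subE h A))
  renAJ-subAJ h (thesis (eqTy A B α)) =
    cong thesis (cong₃ eqTy (renE-subE h A) (renE-subE h B) (renAts-subAts h α))
  renAJ-subAJ h (thesis (eqTm s t A α)) =
    cong thesis (cong₄ eqTm (renE-subE h s) (renE-subE h t) (renE-subE h A) (renAts-subAts h α))
  renAJ-subAJ h (jabs A J) = cong₂ jabs (renE-subE h A) (renAJ-subAJ (liftR-liftS h) J)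

  liftS-id : {σ : Sb m m} → σ ≗ bvar → liftS σ ≗ bvar
  liftS-id h zero = refl
  liftS-id h (suc i) = cong (renE suc) (h i)

  liftSk-id : ∀ k {σ : Sb m m} → σ ≗ bvar → liftSk k σ ≗ bvar
  liftSk-id zero h = h
  liftSk-id (suc k) h = liftSk-id k (liftS-id h)

  subE-id : ∀ {c} {σ : Sb m m} → σ ≗ bvar → (e : Expr opn c m) → subE σ e ≡ e
  subArgs-id : ∀ {as} {σ : Sb m m} → σ ≗ bvar → (e : Args opn m as) →
               subArgs σ e ≡ e
  subArg-id : ∀ {c} {σ : Sb m m} → σ ≗ bvar → (e : Arg opn m c k) →
              subArg σ e ≡ e
  subTms-id : {σ : Sb m m} → σ ≗ bvar → (e : Tms opn m k) → subTms σ e ≡ e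
  subAts-id : {σ : Sb m m} → σ ≗ bvar → (α : List (Atom opn m)) →
              subAts σ α ≡ α

  subE-id h (fvar a A) = refl
  subE-id h (bvar i) = h i
  subE-id h (sym S as) = cong (sym S) (subArgs-id h as)
  subE-id h (meta M B ts) = cong (meta M B) (subTms-id h ts)
  subE-id h (cv t α) = cong₂ cv (subE-id h t) (subAts-id h α)
  subArgs-id h anil = refl
  subArgs-id h (acons a as) = cong₂ acons (subArg-id h a) (subArgs-id h as)
  subArg-id h (aty {k = k} e) = cong aty (subE-id (liftSk-id k h) e)
  subArg-id h (atm {k = k} e) = cong atm (subE-id (liftSk-id k h) e)
  subArg-id h (aeqty {k = k} α) = cong aeqty (subAts-id (liftSk-id k h) α)
  subArg-id h (aeqtm {k = k} α) = cong aeqtm (subAts-id (liftSk-id k h) α)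
  subTms-id h tnil = refl
  subTms-id h (tcons t ts) = cong₂ tcons (subE-id h t) (subTms-id h ts)
  subAts-id h [] = refl
  subAts-id h (afv a A ∷ α) = cong (afv a A ∷_) (subAts-id h α)
  subAts-id h (abv i ∷ α) = cong₂ _++_ (cong asmE (h i)) (subAts-id h α)
  subAts-id h (amv M c B ∷ α) = cong (amv M c B ∷_) (subAts-id h α)

  subAJ-id : {σ : Sb m m} → σ ≗ bvar → (J : AJdg opn m) → subAJ σ J ≡ J
  subAJ-id h (thesis (isTy A)) = cong (thesis ∘ isTy) (subE-id h A)
  subAJ-id h (thesis (hasTy t A)) = cong thesis (cong₂ hasTy (subE-id h t) (subE-id h A))
  subAJ-id h (thesis (eqTy A B α)) =
    cong thesis (cong₃ eqTy (subE-id h A) (subE-id h B) (subAts-id h α))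
  subAJ-id h (thesis (eqTm s t A α)) =
    cong thesis (cong₄ eqTm (subE-id h s) (subE-id h t) (subE-id h A) (subAts-id h α))
  subAJ-id h (jabs A J) = cong₂ jabs (subE-id h A) (subAJ-id (liftS-id h) J)

  subAJ-sub0-wkAJ : (s : Expr opn tm n) (J : AJdg opn n) → subAJ (sub0 s) (wkAJ J) ≡ J
  subAJ-sub0-wkAJ s J = trans (subAJ-renAJ (λ _ → refl) J) (subAJ-id (λ _ → refl) J)

  subAJ-liftS-wkAJ : (σ : Sb m n) (J : AJdg opn m) →
                     subAJ (liftS σ) (wkAJ J) ≡ wkAJ (subAJ σ J)
  subAJ-liftS-wkAJ σ J =
    trans (subAJ-renAJ (λ _ → refl) J) (≡.sym (renAJ-subAJ (λ _ → refl) J))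

  -- Set-equality reflected along injective renamings

  liftR-injective : {ρ : Ren m n} → Injective _≡_ _≡_ ρ → Injective _≡_ _≡_ (liftR ρ)
  liftR-injective inj {zero} {zero} _ = refl
  liftR-injective inj {zero} {suc j} ()
  liftR-injective inj {suc i} {zero} ()
  liftR-injective inj {suc i} {suc j} e = cong suc (inj (suc-injective e))

  liftRk-injective : ∀ k {ρ : Ren m n} → Injective _≡_ _≡_ ρ →
                     Injective _≡_ _≡_ (liftRk k ρ)
  liftRk-injective zero inj = inj
  liftRk-injective (suc k) inj = liftRk-injective k (liftR-injective inj)

  abv-≃at-injective : {i j : Fin n} → _≃at_ {F} (abv i) (abv j) → i ≡ j
  abv-≃at-injective eabv = refl

  ≃at-renAt⁻ : {ρ : Ren m n} → Injective _≡_ _≡_ ρ →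
               (w z : Atom F m) → renAt ρ w ≃at renAt ρ z → w ≃at z
  ≃at-renAt⁻ inj (afv a A) (afv b B) (eafv p) = eafv p
  ≃at-renAt⁻ inj (abv i) (abv j) p with inj (abv-≃at-injective p)
  ... | refl = eabv
  ≃at-renAt⁻ inj (amv M c B) (amv N d C) (eamv p) = eamv p
  ≃at-renAt⁻ inj (afv a A) (abv j) ()
  ≃at-renAt⁻ inj (afv a A) (amv M c B) ()
  ≃at-renAt⁻ inj (abv i) (afv a A) ()
  ≃at-renAt⁻ inj (abv i) (amv M c B) ()
  ≃at-renAt⁻ inj (amv M c B) (afv a A) ()
  ≃at-renAt⁻ inj (amv M c B) (abv j) ()

  Mem-renAts⁻ : {ρ : Ren m n} → Injective _≡_ _≡_ ρ →
                (w : Atom F m) (β : List (Atom F m)) →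
                Mem (renAt ρ w) (renAts ρ β) → Mem w β
  Mem-renAts⁻ inj w (z ∷ β) (here p) = here (≃at-renAt⁻ inj w z p)
  Mem-renAts⁻ inj w (z ∷ β) (there p) = there (Mem-renAts⁻ inj w β p)

  ⊆̃-renAts⁻ : {ρ : Ren m n} → Injective _≡_ _≡_ ρ →
              (α β : List (Atom F m)) → renAts ρ α ⊆̃ renAts ρ β → α ⊆̃ β
  ⊆̃-renAts⁻ inj [] β p = snil
  ⊆̃-renAts⁻ inj (w ∷ α) β (scons m p) =
    scons (Mem-renAts⁻ inj w β m) (⊆̃-renAts⁻ inj α β p)

  ≃at-renAt-preimage : {ρ : Ren m n} (w : Atom F m) {z : Atom F n} →
                       z ≃at renAt ρ w →
                       ∃ λ w′ → (z ≡ renAt ρ w′) × (w′ ≃at w)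
  ≃at-renAt-preimage (afv a A) (eafv p) = afv a _ , refl , eafv p
  ≃at-renAt-preimage (abv i) eabv = abv i , refl , eabv
  ≃at-renAt-preimage (amv M c B) (eamv p) = amv M c _ , refl , eamv p

  Mem-renAts-preimage : {ρ : Ren m n} (α : List (Atom F m)) {z : Atom F n} →
                        Mem z (renAts ρ α) → ∃ λ w → (z ≡ renAt ρ w) × Mem w α
  Mem-renAts-preimage (w ∷ α) (here p) with ≃at-renAt-preimage w p
  ... | w′ , refl , q = w′ , refl , here q
  Mem-renAts-preimage (w ∷ α) (there p) with Mem-renAts-preimage α p
  ... | w′ , refl , q = w′ , refl , there q

  ⊆̃-renAts-preimage : {ρ : Ren m n} (α : List (Atom F m)) {γ : List (Atom F n)} →
                      γ ⊆̃ renAts ρ α →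
                      ∃ λ α′ → (γ ≡ renAts ρ α′) × (α′ ⊆̃ α)
  ⊆̃-renAts-preimage α snil = [] , refl , snil
  ⊆̃-renAts-preimage α (scons m p) with Mem-renAts-preimage α m | ⊆̃-renAts-preimage α p
  ... | w , refl , q | α′ , refl , q′ = w ∷ α′ , refl , scons q q′

  ≈ₛ-renAts-preimage : {ρ : Ren m n} → Injective _≡_ _≡_ ρ →
                       (α : List (Atom F m)) {γ : List (Atom F n)} →
                       γ ⊆̃ renAts ρ α → renAts ρ α ⊆̃ γ →
                       ∃ λ α′ → (γ ≡ renAts ρ α′) ×
                                (α′ ⊆̃ α) × (α ⊆̃ α′)
  ≈ₛ-renAts-preimage inj α p q with ⊆̃-renAts-preimage α p
  ... | α′ , refl , p′ = α′ , refl , p′ , ⊆̃-renAts⁻ inj α α′ q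

  ≃E-renE-preimage : ∀ {c} {ρ : Ren m n} → Injective _≡_ _≡_ ρ →
                     (e : Expr F c m) {e₀ : Expr F c n} → e₀ ≃E renE ρ e →
                     ∃ λ e′ → (e₀ ≡ renE ρ e′) × (e′ ≃E e)
  ≃Args-renArgs-preimage : ∀ {as} {ρ : Ren m n} → Injective _≡_ _≡_ ρ →
                           (e : Args F m as) {e₀ : Args F n as} → e₀ ≃As renArgs ρ e →
                           ∃ λ e′ → (e₀ ≡ renArgs ρ e′) × (e′ ≃As e)
  ≃Arg-renArg-preimage : ∀ {c} {ρ : Ren m n} → Injective _≡_ _≡_ ρ →
                         (e : Arg F m c k) {e₀ : Arg F n c k} → e₀ ≃A renArg ρ e →
                         ∃ λ e′ → (e₀ ≡ renArg ρ e′) × (e′ ≃A e)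
  ≃Tms-renTms-preimage : {ρ : Ren m n} → Injective _≡_ _≡_ ρ →
                         (e : Tms F m k) {e₀ : Tms F n k} → e₀ ≃T renTms ρ e →
                         ∃ λ e′ → (e₀ ≡ renTms ρ e′) × (e′ ≃T e)

  ≃E-renE-preimage inj (fvar a A) (efv p) = fvar a _ , refl , efv p
  ≃E-renE-preimage inj (bvar i) ebv = bvar i , refl , ebv
  ≃E-renE-preimage inj (sym S as) (esym p) with ≃Args-renArgs-preimage inj as p
  ... | as′ , refl , p′ = sym S as′ , refl , esym p′
  ≃E-renE-preimage inj (meta M B ts) (emeta p q) with ≃Tms-renTms-preimage inj ts q
  ... | ts′ , refl , q′ = meta M _ ts′ , refl , emeta p q′
  ≃E-renE-preimage inj (cv t α) (ecv p q r)
    with ≃E-renE-preimage inj t p | ≈ₛ-renAts-preimage inj α q r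
  ... | t′ , refl , p′ | α′ , refl , q′ , r′ = cv t′ α′ , refl , ecv p′ q′ r′
  ≃Args-renArgs-preimage inj anil eanil = anil , refl , eanil
  ≃Args-renArgs-preimage inj (acons a as) (eacons p q)
    with ≃Arg-renArg-preimage inj a p | ≃Args-renArgs-preimage inj as q
  ... | a′ , refl , p′ | as′ , refl , q′ = acons a′ as′ , refl , eacons p′ q′
  ≃Arg-renArg-preimage inj (aty {k = k} e) (eaty p)
    with ≃E-renE-preimage (liftRk-injective k inj) e p
  ... | e′ , refl , p′ = aty e′ , refl , eaty p′
  ≃Arg-renArg-preimage inj (atm {k = k} e) (eatm p)
    with ≃E-renE-preimage (liftRk-injective k inj) e p
  ... | e′ , refl , p′ = atm e′ , refl , eatm p′
  ≃Arg-renArg-preimage inj (aeqty {k = k} α) (eaeqty p q)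
    with ≈ₛ-renAts-preimage (liftRk-injective k inj) α p q
  ... | α′ , refl , p′ , q′ = aeqty α′ , refl , eaeqty p′ q′
  ≃Arg-renArg-preimage inj (aeqtm {k = k} α) (eaeqtm p q)
    with ≈ₛ-renAts-preimage (liftRk-injective k inj) α p q
  ... | α′ , refl , p′ , q′ = aeqtm α′ , refl , eaeqtm p′ q′
  ≃Tms-renTms-preimage inj tnil etnil = tnil , refl , etnil
  ≃Tms-renTms-preimage inj (tcons t ts) (etcons p q)
    with ≃E-renE-preimage inj t p | ≃Tms-renTms-preimage inj ts q
  ... | t′ , refl , p′ | ts′ , refl , q′ = tcons t′ ts′ , refl , etcons p′ q′

  ≃AJ-renAJ-preimage : {ρ : Ren m n} → Injective _≡_ _≡_ ρ →
                       (J : AJdg F m) {J₀ : AJdg F n} → J₀ ≃AJ renAJ ρ J →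
                       ∃ λ J′ → (J₀ ≡ renAJ ρ J′) × (J′ ≃AJ J)
  ≃AJ-renAJ-preimage inj (thesis (isTy A)) (ethesis (eisTy p))
    with ≃E-renE-preimage inj A p
  ... | A′ , refl , p′ = thesis (isTy A′) , refl , ethesis (eisTy p′)
  ≃AJ-renAJ-preimage inj (thesis (hasTy t A)) (ethesis (ehasTy p q))
    with ≃E-renE-preimage inj t p | ≃E-renE-preimage inj A q
  ... | t′ , refl , p′ | A′ , refl , q′ =
    thesis (hasTy t′ A′) , refl , ethesis (ehasTy p′ q′)
  ≃AJ-renAJ-preimage inj (thesis (eqTy A B α)) (ethesis (eeqTy p q r s))
    with ≃E-renE-preimage inj A p | ≃E-renE-preimage inj B q | ≈ₛ-renAts-preimage inj α r s
  ... | A′ , refl , p′ | B′ , refl , q′ | α′ , refl , r′ , s′ =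
    thesis (eqTy A′ B′ α′) , refl , ethesis (eeqTy p′ q′ r′ s′)
  ≃AJ-renAJ-preimage inj (thesis (eqTm s t A α)) (ethesis (eeqTm p q r u v))
    with ≃E-renE-preimage inj s p | ≃E-renE-preimage inj t q | ≃E-renE-preimage inj A r
       | ≈ₛ-renAts-preimage inj α u v
  ... | s′ , refl , p′ | t′ , refl , q′ | A′ , refl , r′ | α′ , refl , u′ , v′ =
    thesis (eqTm s′ t′ A′ α′) , refl , ethesis (eeqTm p′ q′ r′ u′ v′)
  ≃AJ-renAJ-preimage inj (jabs A J) (ejabs p q)
    with ≃E-renE-preimage inj A p | ≃AJ-renAJ-preimage (liftR-injective inj) J q
  ... | A′ , refl , p′ | J′ , refl , q′ = jabs A′ J′ , refl , ejabs p′ q′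

  ∈-unbind1⁻ : {w : Atom F n} (xs : List (Atom F (suc n))) →
               w ∈ unbind1 xs → renAt suc w ∈ xs
  ∈-unbind1⁻ (afv a A ∷ xs) (here refl) = here refl
  ∈-unbind1⁻ (afv a A ∷ xs) (there p) = there (∈-unbind1⁻ xs p)
  ∈-unbind1⁻ (abv zero ∷ xs) p = there (∈-unbind1⁻ xs p)
  ∈-unbind1⁻ (abv (suc i) ∷ xs) (here refl) = here refl
  ∈-unbind1⁻ (abv (suc i) ∷ xs) (there p) = there (∈-unbind1⁻ xs p)
  ∈-unbind1⁻ (amv M c B ∷ xs) (here refl) = here refl
  ∈-unbind1⁻ (amv M c B ∷ xs) (there p) = there (∈-unbind1⁻ xs p)

  ∈-unbind1⁺ : (w : Atom F n) (xs : List (Atom F (suc n))) →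
               renAt suc w ∈ xs → w ∈ unbind1 xs
  ∈-unbind1⁺ (afv a A) (afv b B ∷ xs) (here refl) = here refl
  ∈-unbind1⁺ (abv i) (abv (suc j) ∷ xs) (here refl) = here refl
  ∈-unbind1⁺ (amv M c B) (amv N d C ∷ xs) (here refl) = here refl
  ∈-unbind1⁺ w (afv a A ∷ xs) (there p) = there (∈-unbind1⁺ w xs p)
  ∈-unbind1⁺ w (abv zero ∷ xs) (there p) = ∈-unbind1⁺ w xs p
  ∈-unbind1⁺ w (abv (suc i) ∷ xs) (there p) = there (∈-unbind1⁺ w xs p)
  ∈-unbind1⁺ w (amv M c B ∷ xs) (there p) = there (∈-unbind1⁺ w xs p)

  unbind1-mono : {xs ys : List (Atom F (suc n))} → ys ⊆ xs → unbind1 ys ⊆ unbind1 xs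
  unbind1-mono {xs = xs} {ys} ys⊆xs p = ∈-unbind1⁺ _ xs (ys⊆xs (∈-unbind1⁻ ys p))

  Mem⇒≃at-∈ : {z : Atom F n} {ys : List (Atom F n)} →
              Mem z ys → ∃ λ w → (z ≃at w) × (w ∈ ys)
  Mem⇒≃at-∈ (here q) = _ , q , here refl
  Mem⇒≃at-∈ (there p) with Mem⇒≃at-∈ p
  ... | w , q , r = w , q , there r

  ≃at-∈⇒Mem : {z w : Atom F n} {ys : List (Atom F n)} → z ≃at w → w ∈ ys → Mem z ys
  ≃at-∈⇒Mem q (here refl) = here q
  ≃at-∈⇒Mem q (there p) = there (≃at-∈⇒Mem q p)

  Mem-mono : {z : Atom F n} {xs ys : List (Atom F n)} → ys ⊆ xs → Mem z ys → Mem z xs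
  Mem-mono ys⊆xs m with Mem⇒≃at-∈ m
  ... | w , q , r = ≃at-∈⇒Mem q (ys⊆xs r)

  -- Strengthening

  InImage : Ren m n → Fin n → Set
  InImage {m} ρ i = ∃ λ (j : Fin m) → ρ j ≡ i

  BvInImage : Ren m n → List (Atom F n) → Set
  BvInImage ρ xs = ∀ {i} → abv i ∈ xs → InImage ρ i

  BvInImage-∷⁻ : ∀ {ρ : Ren m n} {x} {xs : List (Atom F n)} →
                 BvInImage ρ (x ∷ xs) → BvInImage ρ xs
  BvInImage-∷⁻ H p = H (there p)

  BvInImage-++⁻ˡ : ∀ {ρ : Ren m n} {xs ys : List (Atom F n)} →
                   BvInImage ρ (xs ++ ys) → BvInImage ρ xs
  BvInImage-++⁻ˡ H p = H (∈-++⁺ˡ p)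

  BvInImage-++⁻ʳ : ∀ {ρ : Ren m n} xs {ys : List (Atom F n)} →
                   BvInImage ρ (xs ++ ys) → BvInImage ρ ys
  BvInImage-++⁻ʳ xs H p = H (∈-++⁺ʳ xs p)

  unbind1-BvInImage : (ρ : Ren m n) (xs : List (Atom F (suc n))) →
                      BvInImage ρ (unbind1 xs) → BvInImage (liftR ρ) xs
  unbind1-BvInImage ρ xs H {zero} p = zero , refl
  unbind1-BvInImage ρ xs H {suc i} p with H (∈-unbind1⁺ (abv i) xs p)
  ... | j , refl = suc j , refl

  unbind-BvInImage : ∀ k (ρ : Ren m n) (xs : List (Atom F (k ⊕ n))) →
                     BvInImage ρ (unbind k xs) → BvInImage (liftRk k ρ) xs
  unbind-BvInImage zero ρ xs H = H
  unbind-BvInImage (suc k) ρ xs H =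
    unbind-BvInImage k (liftR ρ) xs (unbind1-BvInImage ρ (unbind k xs) H)

  strengthenE : ∀ {c} (ρ : Ren m n) (e : Expr F c n) → BvInImage ρ (asmE e) →
                ∃ λ e′ → renE ρ e′ ≡ e
  strengthenArgs : ∀ {as} (ρ : Ren m n) (e : Args F n as) → BvInImage ρ (asmArgs e) →
                   ∃ λ e′ → renArgs ρ e′ ≡ e
  strengthenArg : ∀ {c} (ρ : Ren m n) (e : Arg F n c k) → BvInImage ρ (asmArg e) →
                  ∃ λ e′ → renArg ρ e′ ≡ e
  strengthenTms : (ρ : Ren m n) (e : Tms F n k) → BvInImage ρ (asmTms e) →
                  ∃ λ e′ → renTms ρ e′ ≡ e
  strengthenAts : (ρ : Ren m n) (α : List (Atom F n)) → BvInImage ρ (asmAts α) →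
                  ∃ λ α′ → renAts ρ α′ ≡ α

  strengthenE ρ (fvar a A) H = fvar a A , refl
  strengthenE ρ (bvar i) H with H (here refl)
  ... | j , refl = bvar j , refl
  strengthenE ρ (sym S as) H with strengthenArgs ρ as H
  ... | as′ , refl = sym S as′ , refl
  strengthenE ρ (meta M B ts) H with strengthenTms ρ ts (BvInImage-++⁻ʳ _ (BvInImage-∷⁻ H))
  ... | ts′ , refl = meta M B ts′ , refl
  strengthenE ρ (cv t α) H
    with strengthenE ρ t (BvInImage-++⁻ˡ H) | strengthenAts ρ α (BvInImage-++⁻ʳ _ H)
  ... | t′ , refl | α′ , refl = cv t′ α′ , refl
  strengthenArgs ρ anil H = anil , refl
  strengthenArgs ρ (acons a as) H
    with strengthenArg ρ a (BvInImage-++⁻ˡ H) | strengthenArgs ρ as (BvInImage-++⁻ʳ _ H)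
  ... | a′ , refl | as′ , refl = acons a′ as′ , refl
  strengthenArg ρ (aty {k = k} e) H with strengthenE (liftRk k ρ) e (unbind-BvInImage k ρ _ H)
  ... | e′ , refl = aty e′ , refl
  strengthenArg ρ (atm {k = k} e) H with strengthenE (liftRk k ρ) e (unbind-BvInImage k ρ _ H)
  ... | e′ , refl = atm e′ , refl
  strengthenArg ρ (aeqty {k = k} α) H
    with strengthenAts (liftRk k ρ) α (unbind-BvInImage k ρ _ H)
  ... | α′ , refl = aeqty α′ , refl
  strengthenArg ρ (aeqtm {k = k} α) H
    with strengthenAts (liftRk k ρ) α (unbind-BvInImage k ρ _ H)
  ... | α′ , refl = aeqtm α′ , refl
  strengthenTms ρ tnil H = tnil , refl
  strengthenTms ρ (tcons t ts) H
    with strengthenE ρ t (BvInImage-++⁻ˡ H) | strengthenTms ρ ts (BvInImage-++⁻ʳ _ H)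
  ... | t′ , refl | ts′ , refl = tcons t′ ts′ , refl
  strengthenAts ρ [] H = [] , refl
  strengthenAts ρ (afv a A ∷ α) H with strengthenAts ρ α (BvInImage-++⁻ʳ _ H)
  ... | α′ , refl = afv a A ∷ α′ , refl
  strengthenAts ρ (abv i ∷ α) H with H (here refl) | strengthenAts ρ α (BvInImage-∷⁻ H)
  ... | j , refl | α′ , refl = abv j ∷ α′ , refl
  strengthenAts ρ (amv M c B ∷ α) H with strengthenAts ρ α (BvInImage-++⁻ʳ _ H)
  ... | α′ , refl = amv M c B ∷ α′ , refl

  strengthenAJ : (ρ : Ren m n) (J : AJdg F n) → BvInImage ρ (asmAJ J) →
                 ∃ λ J′ → renAJ ρ J′ ≡ J
  strengthenAJ ρ (thesis (isTy A)) H with strengthenE ρ A H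
  ... | A′ , refl = thesis (isTy A′) , refl
  strengthenAJ ρ (thesis (hasTy t A)) H
    with strengthenE ρ t (BvInImage-++⁻ˡ H) | strengthenE ρ A (BvInImage-++⁻ʳ _ H)
  ... | t′ , refl | A′ , refl = thesis (hasTy t′ A′) , refl
  strengthenAJ ρ (thesis (eqTy A B α)) H
    with strengthenE ρ A (BvInImage-++⁻ˡ H)
       | strengthenE ρ B (BvInImage-++⁻ˡ (BvInImage-++⁻ʳ (asmE A) H))
       | strengthenAts ρ α (BvInImage-++⁻ʳ (asmE B) (BvInImage-++⁻ʳ (asmE A) H))
  ... | A′ , refl | B′ , refl | α′ , refl = thesis (eqTy A′ B′ α′) , refl
  strengthenAJ ρ (thesis (eqTm s t A α)) H
    with strengthenE ρ s (BvInImage-++⁻ˡ H)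
       | strengthenE ρ t (BvInImage-++⁻ˡ (BvInImage-++⁻ʳ (asmE s) H))
       | strengthenE ρ A
           (BvInImage-++⁻ˡ (BvInImage-++⁻ʳ (asmE t) (BvInImage-++⁻ʳ (asmE s) H)))
       | strengthenAts ρ α
           (BvInImage-++⁻ʳ (asmE A) (BvInImage-++⁻ʳ (asmE t) (BvInImage-++⁻ʳ (asmE s) H)))
  ... | s′ , refl | t′ , refl | A′ , refl | α′ , refl =
    thesis (eqTm s′ t′ A′ α′) , refl
  strengthenAJ ρ (jabs A J) H
    with strengthenE ρ A (BvInImage-++⁻ˡ H)
       | strengthenAJ (liftR ρ) J (unbind1-BvInImage ρ (asmAJ J) (BvInImage-++⁻ʳ (asmE A) H))
  ... | A′ , refl | J′ , refl = jabs A′ J′ , refl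

  strengthen-unused : (J : AJdg opn (suc n)) → ¬ (abv zero ∈ asmAJ J) →
                      ∃ λ J′ → wkAJ J′ ≡ J
  strengthen-unused J x∉J = strengthenAJ suc J in-image
    where
    in-image : BvInImage suc (asmAJ J)
    in-image {zero} p = ⊥-elim (x∉J p)
    in-image {suc i} p = i , refl

  -- Dropping an abstraction over an unused variable

  data DropAbs : ∀ {n} → AJdg opn n → AJdg opn n → Set where
    dropped : (A : Expr opn ty n) (J : AJdg opn n) → DropAbs (jabs A (wkAJ J)) J
    under : (B : Expr opn ty n) {X Y : AJdg opn (suc n)} →
            DropAbs X Y → DropAbs (jabs B X) (jabs B Y)

  DropAbs-resp-≃ : {X₀ X Y : AJdg opn n} → X₀ ≃AJ X → DropAbs X Y →
                   ∃ λ Y₀ → DropAbs X₀ Y₀ × (Y₀ ≃AJ Y)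
  DropAbs-resp-≃ (ejabs {A = A₀} _ q) (dropped A J)
    with ≃AJ-renAJ-preimage suc-injective J q
  ... | J₀ , refl , J₀≃J = J₀ , dropped A₀ J₀ , J₀≃J
  DropAbs-resp-≃ (ejabs {A = B₀} p q) (under B r) with DropAbs-resp-≃ q r
  ... | Y₀ , r₀ , Y₀≃Y = jabs B₀ Y₀ , under B₀ r₀ , ejabs p Y₀≃Y

  DropAbs-subAJ : (σ : Sb m n) {X Y : AJdg opn m} → DropAbs X Y →
                  DropAbs (subAJ σ X) (subAJ σ Y)
  DropAbs-subAJ σ (dropped A J) =
    subst (λ Z → DropAbs (jabs (subE σ A) Z) (subAJ σ J))
          (≡.sym (subAJ-liftS-wkAJ σ J)) (dropped (subE σ A) (subAJ σ J))
  DropAbs-subAJ σ (under B r) = under (subE σ B) (DropAbs-subAJ (liftS σ) r)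

  DropAbs-asm-⊆ : {X Y : AJdg opn n} → DropAbs X Y → asmAJ Y ⊆ asmAJ X
  DropAbs-asm-⊆ (dropped A J) p =
    ∈-++⁺ʳ (asmE A) (subst (_ ∈_) (≡.sym (unbind1-asmAJ-wkAJ J)) p)
  DropAbs-asm-⊆ (under B r) = ++⁺ʳ (asmE B) (unbind1-mono (DropAbs-asm-⊆ r))

  DropAbs-wrap : (Γ : Tele k) {X Y : AJdg opn k} →
                 DropAbs X Y → DropAbs (wrap Γ X) (wrap Γ Y)
  DropAbs-wrap ε r = r
  DropAbs-wrap (Γ ▷ B) r = DropAbs-wrap Γ (under B r)

  module _ (T : Theory) where
    open Deriv T

    DropAbs-derivable : ∀ {X Y} → ⊢ X → DropAbs X Y → ⊢ Y
    DropAbs-derivable (j-set ⊢X₀ X₀≃X) r with DropAbs-resp-≃ X₀≃X r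
    ... | Y₀ , r₀ , Y₀≃Y = j-set (DropAbs-derivable ⊢X₀ r₀) Y₀≃Y
    DropAbs-derivable (cf-abstr a _ _ ⊢X[a]) (dropped A J) =
      subst ⊢_ (subAJ-sub0-wkAJ (fvar a A) J) ⊢X[a]
    DropAbs-derivable (cf-abstr a ⊢B a∉X ⊢X[a]) (under B r) =
      cf-abstr a ⊢B (a∉X ∘ Mem-mono (DropAbs-asm-⊆ r))
        (DropAbs-derivable ⊢X[a] (DropAbs-subAJ (sub0 (fvar a B)) r))

    drop-unused-abs : (Γ : Tele k) (A : Expr opn ty k) (J : AJdg opn k) →
                      Derivable T (wrap Γ (jabs A (wkAJ J))) → Derivable T (wrap Γ J)
    drop-unused-abs Γ A J ⊢ΓxJ = DropAbs-derivable ⊢ΓxJ (DropAbs-wrap Γ (dropped A J))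

open Defs

mainTheorem12 : (Sg : Signature) (T : Theory Sg) {k : ℕ} (Γ : Tele Sg k)
                (A : Expr Sg opn ty k) (J : AJdg Sg opn (suc k)) →
                Derivable Sg T (wrap Sg Γ (jabs A J)) →
                ¬ (abv zero ∈ asmAJ Sg J) →
                Σ (AJdg Sg opn k) (λ J' → (wkAJ Sg J' ≡ J) × Derivable Sg T (wrap Sg Γ J'))
mainTheorem12 Sg T Γ A J ⊢ΓxJ x∉J with Strengthening.strengthen-unused Sg J x∉J
... | J′ , refl = J′ , refl , Strengthening.drop-unused-abs Sg T Γ A J′ ⊢ΓxJ
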